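{- Let $M$ be a vf-safe $\Delta$-matroid on ground set $V$. Define $P=\{v\in V: v\text{ is not a coloop of }\max(M+V+v)\}$, $Q=\{v\in V: v\text{ is not a coloop of }\max(M+V*v)\}$, and $R=\{v\in V: v\text{ is not a coloop of }\max(M+V)\}$. Then every element of $V$ belongs to exactly one of $P,Q,R$. Moreover, if $M$ is a binary matroid, then $P=P_0$, $Q=Q_0$, $R=R_0$, where $P_0=\{v\in V\mid \exists X\in\mathcal{CS}_M,\ v\in X,\ X\setminus\{v\}\in\mathcal{CS}_M^\perp\}$, $Q_0=\{v\in V\mid\exists X\in\mathcal{CS}_M^\perp,\ v\in X,\ X\setminus\{v\}\in\mathcal{CS}_M\}$, and $R_0=\{v\in V\mid \exists X\in\mathcal{CS}_M\cap\mathcal{CS}_M^\perp,\ v\in X\}$.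
   Context: A set system is $N=(V,D)$ with $V$ finite, $D\subseteq 2^V$; proper if $D\neq\emptyset$. Twist $N*X=(V,\{Y\triangle X:Y\in D\})$; loop complementation $N+X=(V,D')$ with $Y\in D'$ iff the number of $Z\in D$ with $Y\setminus X\subseteq Z\subseteq Y$ is odd. For $v\in V$, $N*v=N*\{v\}$, $N+v=N+\{v\}$. Operations are applied left to right, so $M+V+v=M+(V\setminus\{v\})$ and $M+V*v=(M+V)*\{v\}$. $\max(N)$ is $(V,\text{inclusion-maximal members of }D)$. A $\Delta$-matroid is a proper set system such that for all $X,Y\in D$, $x\in X\triangle Y$ there is $y\in X\triangle Y$ (possibly $y=x$) with $X\triangle\{x,y\}\in D$; it is vf-safe if every set system obtained from it by finite sequences of twists and loop complementations is a $\Delta$-matroid. Matroids are identified with the set systems of their bases (binary matroids are vf-safe); a coloop of a matroid is an element in every basis. For a binary matroid $M$, $\mathcal{CS}_M\subseteq\mathrm{GF}(2)^V$ is the span of the circuits' incidence vectors, $\mathcal{CS}_M^\perp$ its orthogonal complement under the standard bilinear form, and vectors are identified with their supports. -}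

module Defs where

open import Data.Nat using (ℕ; zero; suc; _%_)
open import Data.Bool using (Bool; true; false; _xor_; _∧_; not; if_then_else_)
open import Data.Fin using (Fin)
import Data.Fin as Fin
open import Data.Fin.Subset using (Subset; inside; outside; _∈_; _∉_; _⊆_; _⊂_; _∩_; _∪_; _─_; _-_; ⁅_⁆; ∣_∣; ⊥)
open import Data.Fin.Subset.Properties using (_⊆?_; _⊂?_)
open import Data.Vec using (Vec; []; _∷_; zipWith; replicate)
open import Data.List using (List; []; _∷_; map; _++_; foldr)
open import Data.Bool.ListAction using (any)
open import Data.Product using (Σ; ∃; _×_; _,_)
open import Relation.Nullary.Decidable using (⌊_⌋)
open import Relation.Binary.PropositionalEquality using (_≡_)
open import Relation.Nullary using (¬_)
open import Data.Sum using (_⊎_)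

-- The ground set V is Fin n; subsets of V (= vectors of GF(2)^V) are Subset n.
-- A set system on V is given by the (decidable) membership of D.
SetSystem : ℕ → Set
SetSystem n = Subset n → Bool

allSubsets : (n : ℕ) → List (Subset n)
allSubsets zero = [] ∷ []
allSubsets (suc n) = map (outside ∷_) (allSubsets n) ++ map (inside ∷_) (allSubsets n)

_△_ : ∀ {n} → Subset n → Subset n → Subset n
X △ Y = zipWith _xor_ X Y

_⋆_ : ∀ {n} → SetSystem n → Subset n → SetSystem n
(D ⋆ X) Y = D (Y △ X)

_⊕_ : ∀ {n} → SetSystem n → Subset n → SetSystem n
_⊕_ {n} D X Y =
  foldr (λ Z b → (D Z ∧ ⌊ (Y ─ X) ⊆? Z ⌋ ∧ ⌊ Z ⊆? Y ⌋) xor b) false (allSubsets n)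

full : ∀ n → Subset n
full n = replicate n inside

Proper : ∀ {n} → SetSystem n → Set
Proper D = ∃ λ Y → D Y ≡ true

IsDeltaMatroid : ∀ {n} → SetSystem n → Set
IsDeltaMatroid {n} D =
  Proper D ×
  (∀ X Y (x : Fin n) → D X ≡ true → D Y ≡ true → x ∈ (X △ Y) →
     ∃ λ (y : Fin n) → y ∈ (X △ Y) × D (X △ (⁅ x ⁆ ∪ ⁅ y ⁆)) ≡ true)

data Reachable {n : ℕ} (D : SetSystem n) : SetSystem n → Set where
  start : Reachable D D
  twist : ∀ {N} → Reachable D N → (X : Subset n) → Reachable D (N ⋆ X)
  loopc : ∀ {N} → Reachable D N → (X : Subset n) → Reachable D (N ⊕ X)

VFSafe : ∀ {n} → SetSystem n → Set
VFSafe D = ∀ N → Reachable D N → IsDeltaMatroid N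

maxSS : ∀ {n} → SetSystem n → SetSystem n
maxSS {n} D Y = D Y ∧ not (any (λ Z → D Z ∧ ⌊ Y ⊂? Z ⌋) (allSubsets n))

IsColoop : ∀ {n} → SetSystem n → Fin n → Set
IsColoop D v = ∀ Y → D Y ≡ true → v ∈ Y

InP InQ InR : ∀ {n} → SetSystem n → Fin n → Set
InP {n} M v = ¬ IsColoop (maxSS ((M ⊕ full n) ⊕ ⁅ v ⁆)) v
InQ {n} M v = ¬ IsColoop (maxSS ((M ⊕ full n) ⋆ ⁅ v ⁆)) v
InR {n} M v = ¬ IsColoop (maxSS (M ⊕ full n)) v

zeros : ∀ m → Vec Bool m
zeros m = replicate m false

_+ᵥ_ : ∀ {m} → Vec Bool m → Vec Bool m → Vec Bool m
u +ᵥ w = zipWith _xor_ u w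

colSum : ∀ {n m} → (Fin n → Vec Bool m) → Subset n → Vec Bool m
colSum {zero} {m} f [] = zeros m
colSum {suc n} {m} f (b ∷ Y) =
  (if b then f Fin.zero else zeros m) +ᵥ colSum (λ i → f (Fin.suc i)) Y

LinIndep : ∀ {n m} → (Fin n → Vec Bool m) → Subset n → Set
LinIndep {n} {m} f X = ∀ Y → Y ⊆ X → colSum f Y ≡ zeros m → Y ≡ ⊥

IsVectorBasis : ∀ {n m} → (Fin n → Vec Bool m) → Subset n → Set
IsVectorBasis f X = LinIndep f X × (∀ Y → X ⊆ Y → LinIndep f Y → Y ≡ X)

IsBinaryMatroid : ∀ {n} → SetSystem n → Set
IsBinaryMatroid {n} D =
  Σ ℕ λ m → Σ (Fin n → Vec Bool m) λ f →
    ∀ X → (D X ≡ true → IsVectorBasis f X) × (IsVectorBasis f X → D X ≡ true)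

Independent : ∀ {n} → SetSystem n → Subset n → Set
Independent D X = ∃ λ B → D B ≡ true × X ⊆ B

IsCircuit : ∀ {n} → SetSystem n → Subset n → Set
IsCircuit D C = ¬ Independent D C × (∀ Y → Y ⊂ C → Independent D Y)

data InCS {n : ℕ} (D : SetSystem n) : Subset n → Set where
  cs-zero : InCS D ⊥
  cs-add  : ∀ {X C} → InCS D X → IsCircuit D C → InCS D (X △ C)

InCSperp : ∀ {n} → SetSystem n → Subset n → Set
InCSperp D Y = ∀ X → InCS D X → ∣ X ∩ Y ∣ % 2 ≡ 0

InP0 InQ0 InR0 : ∀ {n} → SetSystem n → Fin n → Set
InP0 M v = ∃ λ X → InCS M X × v ∈ X × InCSperp M (X - v)
InQ0 M v = ∃ λ X → InCSperp M X × v ∈ X × InCS M (X - v)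
InR0 M v = ∃ λ X → (InCS M X × InCSperp M X) × v ∈ X

_⇔_ : Set → Set → Set
A ⇔ B = (A → B) × (B → A)

ExactlyOne : Set → Set → Set → Set
ExactlyOne A B C = (A × ¬ B × ¬ C) ⊎ (¬ A × B × ¬ C) ⊎ (¬ A × ¬ B × C)

{-# OPTIONS --safe #-}

module Submission where

open import Defs
open import Algebra.Bundles using (CommutativeRing)
import Algebra.Properties.CommutativeSemigroup as CommutativeSemigroup
open import Data.Bool as Bool using (Bool; true; false; not; _∧_; _∨_; _xor_; if_then_else_)
open import Data.Bool.ListAction using (any)
open import Data.Bool.Properties using (not-involutive; ∧-identityʳ; ∧-zeroʳ; ∨-zeroʳ; ∨-identityʳ; ∨-idem; ∧-distribʳ-xor; xor-assoc; xor-comm; xor-same; xor-identityʳ; xor-∧-commutativeRing)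
import Data.Empty as Empty
open import Data.Fin using (Fin; zero; suc)
import Data.Fin.Properties as Fin
open import Data.Fin.Subset using (Subset; inside; outside; _⊆_; _⊂_; _∩_; _∪_; _─_; _-_; ⁅_⁆; ∣_∣; ⊥)
open import Data.Fin.Subset.Properties using (_⊆?_; _⊂?_; p⊆q⇒∣p∣≤∣q∣; p⊂q⇒∣p∣<∣q∣; ∣p∣≤n; anySubset?; ⊆-antisym; ∩-comm; ∪-idem; drop-∷-⊆; out⊆; in⊆in; x∈⁅x⁆; x∈⁅y⁆⇒x≡y; p─⊥≡p)
open import Data.List as List using (List; []; _∷_; _++_; foldr)
open import Data.List.Membership.Propositional using () renaming (_∈_ to _∈ₗ_)
open import Data.List.Membership.Propositional.Properties using (∈-map⁺; ∈-++⁺ˡ; ∈-++⁺ʳ; ∈-cartesianProduct⁺)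
import Data.List.Relation.Unary.Any as Any
open import Data.Nat as ℕ using (ℕ; zero; suc; _≤_; _<_; s≤s⁻¹; _%_)
open import Data.Nat.DivMod using (%-distribˡ-+)
import Data.Nat.Properties as ℕ
open import Data.Product using (∃; ∃₂; _×_; _,_; proj₁; proj₂)
open import Data.Sum using (_⊎_; inj₁; inj₂)
open import Data.Vec as Vec using (Vec; []; _∷_; lookup; updateAt; here; _[_]≔_)
open import Data.Vec.Properties using (lookup∘updateAt; lookup∘updateAt′; lookup∘update; lookup∘update′; updateAt-commutes; updateAt-updateAt; updateAt-id-local; lookup-zipWith; zipWith-assoc; lookup-replicate; lookup-map; map-updateAt; []=⇒lookup; lookup⇒[]=; ≡-dec)
open import Function using (_∘_)
open import Relation.Binary.PropositionalEquality using (_≡_; _≢_; refl; sym; trans; cong; cong₂; subst; subst₂; ≢-sym; module ≡-Reasoning)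
open import Relation.Nullary using (¬_; Dec; yes; no; contradiction)
open import Relation.Nullary.Decidable using (⌊_⌋; _×-dec_; ¬?; _→-dec_)

open CommutativeSemigroup (CommutativeRing.+-commutativeSemigroup xor-∧-commutativeRing) using (interchange)

-- Write A and B for the minors N∖v and N/v of N = M + V; then (N + v)/v = A △ B. As the maximal members
-- of a Δ-matroid are equicardinal, membership of v in R, Q or P says that the maximum cardinality of
-- A exceeds that of B, that of B exceeds that of A, or that of A exceeds that of A △ B. These are
-- exclusive, and they exhaust all cases unless A, B and A △ B have the same maximum cardinality. In that
-- situation exchanges lead between largest members with different status, and at the transition a minor
-- on three elements is not vf-safe.
--
-- For a binary matroid with cycle space K and L = K^⊥, the space L × K is Lagrangian for the symplectic
-- form of pairs (x , y). A choice T of one of the lines x = 0, y = 0, x = y at each element is called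
-- transverse if L × K has no nonzero vector lying on all chosen lines. Given the other choices, an even
-- number of the three lines at an element is transverse; hence loop complementation exchanges the
-- lines x = 0 and x = y. The bases of M are the sets Y for which x = 0 on Y, y = 0 off Y is transverse, so
-- Y ∈ M + V iff x = y on Y, y = 0 off Y is transverse. An orthogonality argument at a largest such Y
-- produces a vector of L × K on the diagonal x = y except possibly at v, and its nonzero component at v,
-- (0,1), (1,0) or (1,1), gives v ∈ P₀, Q₀ or R₀. Isotropy makes these three sets disjoint.

private variable
  m n k : ℕ
  A B : Set

-- Booleans and decidable propositions

true≢false : ∀ {b} → b ≡ true → b ≡ false → A
true≢false refl ()

≢true⇒false : ∀ {b} → b ≢ true → b ≡ false
≢true⇒false {false} _ = refl
≢true⇒false {true}  h = contradiction refl h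

⌊⌋-cong : (a? : Dec A) (b? : Dec B) → (A → B) → (B → A) → ⌊ a? ⌋ ≡ ⌊ b? ⌋
⌊⌋-cong (yes a) (yes b) f g = refl
⌊⌋-cong (yes a) (no ¬b) f g = contradiction (f a) ¬b
⌊⌋-cong (no ¬a) (yes b) f g = contradiction (g b) ¬a
⌊⌋-cong (no ¬a) (no ¬b) f g = refl

⌊⌋-false : (a? : Dec A) → ¬ A → ⌊ a? ⌋ ≡ false
⌊⌋-false (yes a) ¬a = contradiction a ¬a
⌊⌋-false (no _)  _  = refl

⌊⌋-true : (a? : Dec A) → A → ⌊ a? ⌋ ≡ true
⌊⌋-true (yes _) _ = refl
⌊⌋-true (no ¬a) a = contradiction a ¬a

-- Toggling elements of a subset

lookup-ext : {X Y : Vec A n} → (∀ i → lookup X i ≡ lookup Y i) → X ≡ Y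
lookup-ext {X = []}    {[]}    h = refl
lookup-ext {X = x ∷ X} {y ∷ Y} h = cong₂ _∷_ (h zero) (lookup-ext (h ∘ suc))

toggle : Subset n → Fin n → Subset n
toggle X i = updateAt X i not

toggle-self : ∀ (X : Subset n) i → lookup (toggle X i) i ≡ not (lookup X i)
toggle-self X i = lookup∘updateAt i X

toggle-other : ∀ (X : Subset n) {i j} → j ≢ i → lookup (toggle X i) j ≡ lookup X j
toggle-other X {i} {j} j≢i = lookup∘updateAt′ j i j≢i X

toggle-comm : ∀ (X : Subset n) {i j} → i ≢ j → toggle (toggle X i) j ≡ toggle (toggle X j) i
toggle-comm X {i} {j} i≢j = updateAt-commutes j i (≢-sym i≢j) X

toggle-involutive : ∀ (X : Subset n) i → toggle (toggle X i) i ≡ X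
toggle-involutive X i =
  trans (updateAt-updateAt i X) (updateAt-id-local i X (not-involutive _))

toggle-on : ∀ (X : Subset n) i {b} → lookup X i ≡ b → lookup (toggle X i) i ≡ not b
toggle-on X i eq = trans (toggle-self X i) (cong not eq)

toggle-off : ∀ (X : Subset n) {i j b} → j ≢ i → lookup X j ≡ b → lookup (toggle X i) j ≡ b
toggle-off X j≢i eq = trans (toggle-other X j≢i) eq

∣toggle∣-out : ∀ (X : Subset n) i → lookup X i ≡ false → ∣ toggle X i ∣ ≡ suc ∣ X ∣
∣toggle∣-out (false ∷ X) zero    eq = refl
∣toggle∣-out (false ∷ X) (suc i) eq = ∣toggle∣-out X i eq
∣toggle∣-out (true ∷ X)  (suc i) eq = cong suc (∣toggle∣-out X i eq)

∣toggle∣-in : ∀ (X : Subset n) i → lookup X i ≡ true → suc ∣ toggle X i ∣ ≡ ∣ X ∣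
∣toggle∣-in (true ∷ X)  zero    eq = refl
∣toggle∣-in (false ∷ X) (suc i) eq = ∣toggle∣-in X i eq
∣toggle∣-in (true ∷ X)  (suc i) eq = cong suc (∣toggle∣-in X i eq)

△-lookup : ∀ (X Y : Subset n) i → lookup (X △ Y) i ≡ lookup X i xor lookup Y i
△-lookup X Y i = lookup-zipWith _xor_ i X Y

⁅⁆-self : ∀ (i : Fin n) → lookup ⁅ i ⁆ i ≡ true
⁅⁆-self i = []=⇒lookup (x∈⁅x⁆ i)

⁅⁆-other : ∀ {i j : Fin n} → j ≢ i → lookup ⁅ i ⁆ j ≡ false
⁅⁆-other {i = i} {j} j≢i =
  ≢true⇒false (λ eq → j≢i (x∈⁅y⁆⇒x≡y i (lookup⇒[]= j ⁅ i ⁆ eq)))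

△-⁅⁆ : ∀ (X : Subset n) i → X △ ⁅ i ⁆ ≡ toggle X i
△-⁅⁆ X i = lookup-ext pointwise
  where
  pointwise : ∀ j → lookup (X △ ⁅ i ⁆) j ≡ lookup (toggle X i) j
  pointwise j rewrite △-lookup X ⁅ i ⁆ j with j Fin.≟ i
  ... | yes refl rewrite ⁅⁆-self j | toggle-self X j = xor-comm (lookup X j) true
  ... | no j≢i rewrite ⁅⁆-other j≢i | toggle-other X j≢i = xor-identityʳ _

△-⁅⁆∪⁅⁆ : ∀ (X : Subset n) i {j} → j ≢ i → X △ (⁅ i ⁆ ∪ ⁅ j ⁆) ≡ toggle (toggle X i) j
△-⁅⁆∪⁅⁆ X i {j} j≢i = lookup-ext pointwise
  where
  pointwise : ∀ l → lookup (X △ (⁅ i ⁆ ∪ ⁅ j ⁆)) l ≡ lookup (toggle (toggle X i) j) l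
  pointwise l rewrite △-lookup X (⁅ i ⁆ ∪ ⁅ j ⁆) l
                    | lookup-zipWith _∨_ l ⁅ i ⁆ ⁅ j ⁆ with l Fin.≟ j
  ... | yes refl rewrite ⁅⁆-self l | ⁅⁆-other j≢i | toggle-self (toggle X i) l
                       | toggle-other X j≢i = xor-comm (lookup X l) true
  ... | no l≢j rewrite ⁅⁆-other l≢j | toggle-other (toggle X i) l≢j with l Fin.≟ i
  ...   | yes refl rewrite ⁅⁆-self l | toggle-self X l = xor-comm (lookup X l) true
  ...   | no l≢i rewrite ⁅⁆-other l≢i | toggle-other X l≢i = xor-identityʳ _

△-⁅⁆∪⁅⁆-same : ∀ (X : Subset n) i → X △ (⁅ i ⁆ ∪ ⁅ i ⁆) ≡ toggle X i
△-⁅⁆∪⁅⁆-same X i = trans (cong (X △_) (∪-idem ⁅ i ⁆)) (△-⁅⁆ X i)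

toggle-△ : ∀ (X Y : Subset n) i → toggle X i △ Y ≡ toggle (X △ Y) i
toggle-△ (x ∷ X) (y ∷ Y) zero    = cong (_∷ (X △ Y)) (not-xor x y)
  where
  not-xor : ∀ a b → not a xor b ≡ not (a xor b)
  not-xor false b = refl
  not-xor true  b = sym (not-involutive b)
toggle-△ (x ∷ X) (y ∷ Y) (suc i) = cong ((x xor y) ∷_) (toggle-△ X Y i)

-- Evaluating loop complementation

xsum : (A → Bool) → List A → Bool
xsum f = foldr (λ z b → f z xor b) false

xsum-cong : {f g : A → Bool} → (∀ z → f z ≡ g z) → ∀ zs → xsum f zs ≡ xsum g zs
xsum-cong h []       = refl
xsum-cong h (z ∷ zs) = cong₂ _xor_ (h z) (xsum-cong h zs)

xsum-false : {f : A → Bool} → (∀ z → f z ≡ false) → ∀ zs → xsum f zs ≡ false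
xsum-false h []       = refl
xsum-false h (z ∷ zs) = cong₂ _xor_ (h z) (xsum-false h zs)

xsum-++ : (f : A → Bool) → ∀ zs ws → xsum f (zs ++ ws) ≡ xsum f zs xor xsum f ws
xsum-++ f []       ws = refl
xsum-++ f (z ∷ zs) ws = trans (cong (f z xor_) (xsum-++ f zs ws))
  (sym (xor-assoc (f z) (xsum f zs) (xsum f ws)))

xsum-map : (f : B → Bool) (g : A → B) → ∀ zs → xsum f (List.map g zs) ≡ xsum (f ∘ g) zs
xsum-map f g []       = refl
xsum-map f g (z ∷ zs) = cong (f (g z) xor_) (xsum-map f g zs)

-- The deletion (`outside`) and the contraction (`inside`) of the first element; induction on the
-- ground set runs along these minors.
slice : SetSystem (suc n) → Bool → SetSystem n
slice D b Y = D (b ∷ Y)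

private
  between : SetSystem n → Subset n → Subset n → Subset n → Bool
  between D X Y Z = D Z ∧ ⌊ (Y ─ X) ⊆? Z ⌋ ∧ ⌊ Z ⊆? Y ⌋

  ⊆-out : ∀ {b} {X Y : Subset n} → ⌊ (outside ∷ X) ⊆? (b ∷ Y) ⌋ ≡ ⌊ X ⊆? Y ⌋
  ⊆-out {b = b} {X} {Y} = ⌊⌋-cong _ (X ⊆? Y) drop-∷-⊆ out⊆

  ⊆-in : ∀ {X Y : Subset n} → ⌊ (inside ∷ X) ⊆? (inside ∷ Y) ⌋ ≡ ⌊ X ⊆? Y ⌋
  ⊆-in {X = X} {Y} = ⌊⌋-cong _ (X ⊆? Y) drop-∷-⊆ in⊆in

  ⊈-in-out : ∀ {X Y : Subset n} → ⌊ (inside ∷ X) ⊆? (outside ∷ Y) ⌋ ≡ false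
  ⊈-in-out {X = X} {Y} = ⌊⌋-false ((inside ∷ X) ⊆? (outside ∷ Y)) λ h → contradiction (h here) λ ()

  ⊕-split : ∀ (D : SetSystem (suc n)) X Y → (D ⊕ X) Y ≡
    xsum (λ Z → between D X Y (outside ∷ Z)) (allSubsets n) xor
    xsum (λ Z → between D X Y (inside ∷ Z)) (allSubsets n)
  ⊕-split {n} D X Y = trans
    (xsum-++ (between D X Y) (List.map (outside ∷_) (allSubsets n)) _)
    (cong₂ _xor_ (xsum-map (between D X Y) (outside ∷_) (allSubsets n))
                 (xsum-map (between D X Y) (inside ∷_) (allSubsets n)))

-- Every counted `Z` lies inside a set without the first element, so only the deletion contributes.
⊕-out : ∀ (D : SetSystem (suc n)) X Y x →
  (D ⊕ (x ∷ X)) (outside ∷ Y) ≡ (slice D outside ⊕ X) Y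
⊕-out {n} D X Y x = trans (⊕-split D (x ∷ X) (outside ∷ Y)) (trans
  (cong₂ _xor_ (xsum-cong (left x) (allSubsets n)) (xsum-false right (allSubsets n)))
  (xor-identityʳ _))
  where
  left : ∀ x Z → between D (x ∷ X) (outside ∷ Y) (outside ∷ Z) ≡ between (slice D outside) X Y Z
  left inside  Z = cong₂ (λ a b → D (outside ∷ Z) ∧ a ∧ b)
    (⊆-out {b = outside} {Y ─ X} {Z}) (⊆-out {b = outside} {Z} {Y})
  left outside Z = cong₂ (λ a b → D (outside ∷ Z) ∧ a ∧ b)
    (⊆-out {b = outside} {Y ─ X} {Z}) (⊆-out {b = outside} {Z} {Y})
  right : ∀ Z → between D (x ∷ X) (outside ∷ Y) (inside ∷ Z) ≡ false
  right Z = trans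
    (cong (λ b → D (inside ∷ Z) ∧ ⌊ ((outside ∷ Y) ─ (x ∷ X)) ⊆? (inside ∷ Z) ⌋ ∧ b) (⊈-in-out {X = Z} {Y}))
    (trans (cong (D (inside ∷ Z) ∧_) (∧-zeroʳ _)) (∧-zeroʳ _))

private
  ⊕-in-right : ∀ (D : SetSystem (suc n)) X Y x Z →
    between D (x ∷ X) (inside ∷ Y) (inside ∷ Z) ≡ between (slice D inside) X Y Z
  ⊕-in-right D X Y inside  Z = cong₂ (λ a b → D (inside ∷ Z) ∧ a ∧ b)
    (⊆-out {b = inside} {Y ─ X} {Z}) (⊆-in {X = Z} {Y})
  ⊕-in-right D X Y outside Z = cong₂ (λ a b → D (inside ∷ Z) ∧ a ∧ b)
    (⊆-in {X = Y ─ X} {Z}) (⊆-in {X = Z} {Y})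

-- The first element survives in the lower bound `Y ─ X`, which forces it into every counted `Z`.
⊕-keep : ∀ (D : SetSystem (suc n)) X Y →
  (D ⊕ (outside ∷ X)) (inside ∷ Y) ≡ (slice D inside ⊕ X) Y
⊕-keep {n} D X Y = trans (⊕-split D (outside ∷ X) (inside ∷ Y))
  (cong₂ _xor_ (xsum-false left (allSubsets n))
               (xsum-cong (⊕-in-right D X Y outside) (allSubsets n)))
  where
  left : ∀ Z → between D (outside ∷ X) (inside ∷ Y) (outside ∷ Z) ≡ false
  left Z = trans (cong (λ b → D (outside ∷ Z) ∧ b ∧ ⌊ (outside ∷ Z) ⊆? (inside ∷ Y) ⌋)
                       (⊈-in-out {X = Y ─ X} {Z}))
                 (∧-zeroʳ _)

-- The first element has left the lower bound but remains in the upper one, so it is free in `Z` and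
-- both minors are counted.
⊕-in : ∀ (D : SetSystem (suc n)) X Y →
  (D ⊕ (inside ∷ X)) (inside ∷ Y) ≡ (slice D outside ⊕ X) Y xor (slice D inside ⊕ X) Y
⊕-in {n} D X Y = trans (⊕-split D (inside ∷ X) (inside ∷ Y))
  (cong₂ _xor_ (xsum-cong left (allSubsets n))
               (xsum-cong (⊕-in-right D X Y inside) (allSubsets n)))
  where
  left : ∀ Z → between D (inside ∷ X) (inside ∷ Y) (outside ∷ Z) ≡ between (slice D outside) X Y Z
  left Z = cong₂ (λ a b → D (outside ∷ Z) ∧ a ∧ b)
    (⊆-out {b = outside} {Y ─ X} {Z}) (⊆-out {b = inside} {Z} {Y})

⊕-[] : ∀ (D : SetSystem 0) → (D ⊕ []) [] ≡ D []
⊕-[] D = trans (xor-identityʳ _) (∧-identityʳ _)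

⊕-⊥ : ∀ (D : SetSystem n) Y → (D ⊕ ⊥) Y ≡ D Y
⊕-⊥ D []            = ⊕-[] D
⊕-⊥ D (outside ∷ Y) = trans (⊕-out D ⊥ Y outside) (⊕-⊥ (slice D outside) Y)
⊕-⊥ D (inside ∷ Y)  = trans (⊕-keep D ⊥ Y) (⊕-⊥ (slice D inside) Y)

⊕⁅⁆-out : ∀ (D : SetSystem n) v Y → lookup Y v ≡ false → (D ⊕ ⁅ v ⁆) Y ≡ D Y
⊕⁅⁆-out D zero    (outside ∷ Y) _  = trans (⊕-out D ⊥ Y inside) (⊕-⊥ (slice D outside) Y)
⊕⁅⁆-out D (suc v) (outside ∷ Y) eq = trans (⊕-out D ⁅ v ⁆ Y outside) (⊕⁅⁆-out (slice D outside) v Y eq)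
⊕⁅⁆-out D (suc v) (inside ∷ Y)  eq = trans (⊕-keep D ⁅ v ⁆ Y) (⊕⁅⁆-out (slice D inside) v Y eq)

⊕⁅⁆-in : ∀ (D : SetSystem n) v Y → lookup Y v ≡ false →
  (D ⊕ ⁅ v ⁆) (toggle Y v) ≡ D Y xor D (toggle Y v)
⊕⁅⁆-in D zero    (outside ∷ Y) _  = trans (⊕-in D ⊥ Y)
  (cong₂ _xor_ (⊕-⊥ (slice D outside) Y) (⊕-⊥ (slice D inside) Y))
⊕⁅⁆-in D (suc v) (outside ∷ Y) eq =
  trans (⊕-out D ⁅ v ⁆ (toggle Y v) outside) (⊕⁅⁆-in (slice D outside) v Y eq)
⊕⁅⁆-in D (suc v) (inside ∷ Y)  eq =
  trans (⊕-keep D ⁅ v ⁆ (toggle Y v)) (⊕⁅⁆-in (slice D inside) v Y eq)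

⋆⁅⁆ : ∀ (D : SetSystem n) v Y → (D ⋆ ⁅ v ⁆) Y ≡ D (toggle Y v)
⋆⁅⁆ D v Y = cong D (△-⁅⁆ Y v)

-- Largest members of a Δ-matroid

xor-≢ : ∀ {a b} → a ≢ b → a xor b ≡ true
xor-≢ {false} {false} h = contradiction refl h
xor-≢ {false} {true}  h = refl
xor-≢ {true}  {false} h = refl
xor-≢ {true}  {true}  h = contradiction refl h

xor-true⇒≢ : ∀ {a b} → a xor b ≡ true → a ≢ b
xor-true⇒≢ {false} () refl
xor-true⇒≢ {true}  () refl

∣△∣-toggle : ∀ (X Y : Subset n) i → lookup X i ≢ lookup Y i → suc ∣ toggle X i △ Y ∣ ≡ ∣ X △ Y ∣
∣△∣-toggle X Y i X≢Y rewrite toggle-△ X Y i =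
  ∣toggle∣-in (X △ Y) i (trans (△-lookup X Y i) (xor-≢ X≢Y))

-- The axiom allows y = x. This case becomes an alternative of its own, so that otherwise two
-- distinct elements change.
exchange : ∀ {D : SetSystem n} → IsDeltaMatroid D → ∀ X Y x →
  D X ≡ true → D Y ≡ true → lookup X x ≢ lookup Y x →
  D (toggle X x) ≡ true ⊎
  ∃ λ y → y ≢ x × lookup X y ≢ lookup Y y × D (toggle (toggle X x) y) ≡ true
exchange {D = D} (_ , ex) X Y x DX DY X≢Y
  with ex X Y x DX DY (lookup⇒[]= x (X △ Y) (trans (△-lookup X Y x) (xor-≢ X≢Y)))
... | y , y∈ , Dy with y Fin.≟ x
...   | yes refl = inj₁ (subst (λ Z → D Z ≡ true) (△-⁅⁆∪⁅⁆-same X x) Dy)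
...   | no y≢x = inj₂ (y , y≢x
  , xor-true⇒≢ (trans (sym (△-lookup X Y y)) ([]=⇒lookup y∈))
  , subst (λ Z → D Z ≡ true) (△-⁅⁆∪⁅⁆ X x y≢x) Dy)

Largest : SetSystem n → Subset n → Set
Largest D X = D X ≡ true × (∀ Z → D Z ≡ true → ∣ Z ∣ ≤ ∣ X ∣)

⊆-lookup : ∀ {X Y : Subset n} → (∀ i → lookup X i ≡ true → lookup Y i ≡ true) → X ⊆ Y
⊆-lookup {Y = Y} h i∈X = lookup⇒[]= _ Y (h _ ([]=⇒lookup i∈X))

lookup-⊆ : ∀ {X Y : Subset n} → X ⊆ Y → ∀ i → lookup X i ≡ true → lookup Y i ≡ true
lookup-⊆ {X = X} h i eq = []=⇒lookup (h (lookup⇒[]= i X eq))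

⊆⊎∃ : ∀ (X Y : Subset n) → X ⊆ Y ⊎ ∃ λ i → lookup X i ≡ true × lookup Y i ≡ false
⊆⊎∃ X Y with Fin.any? (λ i → (lookup X i Bool.≟ true) ×-dec (lookup Y i Bool.≟ false))
... | yes p = inj₂ p
... | no ¬p = inj₁ (⊆-lookup λ i Xi → yes-in i Xi)
  where
  yes-in : ∀ i → lookup X i ≡ true → lookup Y i ≡ true
  yes-in i Xi with lookup Y i in eq
  ... | true  = refl
  ... | false = contradiction (i , Xi , eq) ¬p

maximal⇒largest : ∀ {D : SetSystem n} → IsDeltaMatroid D → ∀ X → D X ≡ true →
  (∀ Z → D Z ≡ true → ¬ X ⊂ Z) → Largest D X
maximal⇒largest {n} {D} isΔ X DX maximal = DX , λ Z DZ → ℕ.≮⇒≥ (go _ Z ℕ.≤-refl DZ)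
  where
  -- Among the larger members, exchange on an element of X ∖ Z moves Z towards X without shrinking it.
  go : ∀ k Z → ∣ Z △ X ∣ ≤ k → D Z ≡ true → ¬ ∣ X ∣ < ∣ Z ∣
  go k Z d≤k DZ X<Z with ⊆⊎∃ X Z
  ... | inj₁ X⊆Z with ⊆⊎∃ Z X
  ...   | inj₁ Z⊆X = ℕ.<⇒≱ X<Z (p⊆q⇒∣p∣≤∣q∣ Z⊆X)
  ...   | inj₂ (z , Zz , Xz) = maximal Z DZ
    (X⊆Z , z , lookup⇒[]= z Z Zz , λ z∈X → true≢false ([]=⇒lookup z∈X) Xz)
  go k Z d≤k DZ X<Z | inj₂ (x , Xx , Zx) = step k d≤k
    where
    Z≢X : lookup Z x ≢ lookup X x
    Z≢X eq = true≢false (trans eq Xx) Zx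
    bigger : ∣ toggle Z x ∣ ≡ suc ∣ Z ∣
    bigger = ∣toggle∣-out Z x Zx
    closer : suc ∣ toggle Z x △ X ∣ ≡ ∣ Z △ X ∣
    closer = ∣△∣-toggle Z X x Z≢X
    step : ∀ k → ∣ Z △ X ∣ ≤ k → Empty.⊥
    step zero    d≤k = contradiction (ℕ.≤-trans (ℕ.≤-reflexive closer) d≤k) λ ()
    step (suc k) d≤k = by-exchange (exchange isΔ Z X x DZ DX Z≢X)
      where
      d′≤k : ∣ toggle Z x △ X ∣ ≤ k
      d′≤k = s≤s⁻¹ (ℕ.≤-trans (ℕ.≤-reflexive closer) d≤k)
      by-exchange : D (toggle Z x) ≡ true ⊎
        (∃ λ y → y ≢ x × lookup Z y ≢ lookup X y × D (toggle (toggle Z x) y) ≡ true) → Empty.⊥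
      by-exchange (inj₁ DZx) = go k (toggle Z x) d′≤k DZx
        (ℕ.<-≤-trans X<Z (ℕ.≤-trans (ℕ.n≤1+n _) (ℕ.≤-reflexive (sym bigger))))
      by-exchange (inj₂ (y , y≢x , Zy≢Xy , DZxy)) =
        go k (toggle (toggle Z x) y) d″≤k DZxy (ℕ.<-≤-trans X<Z not-smaller)
        where
        d″≤k : ∣ toggle (toggle Z x) y △ X ∣ ≤ k
        d″≤k = ℕ.≤-trans (ℕ.n≤1+n _) (ℕ.≤-trans
          (ℕ.≤-reflexive (∣△∣-toggle (toggle Z x) X y (λ eq → Zy≢Xy (trans (sym (toggle-other Z y≢x)) eq)))) d′≤k)
        -- Since `x` has been added, removing `y` restores the size of `Z`, and adding `y` increases
        -- that size by two.
        not-smaller : ∣ Z ∣ ≤ ∣ toggle (toggle Z x) y ∣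
        not-smaller with lookup (toggle Z x) y in eq
        ... | true  = s≤s⁻¹ (ℕ.≤-reflexive (trans (sym bigger) (sym (∣toggle∣-in (toggle Z x) y eq))))
        ... | false = ℕ.≤-trans (ℕ.n≤1+n _) (ℕ.≤-trans (ℕ.n≤1+n _)
          (ℕ.≤-reflexive (sym (trans (∣toggle∣-out (toggle Z x) y eq) (cong suc bigger)))))

∈-allSubsets : ∀ (X : Subset n) → X ∈ₗ allSubsets n
∈-allSubsets []            = Any.here refl
∈-allSubsets (outside ∷ X) = ∈-++⁺ˡ (∈-map⁺ (outside ∷_) (∈-allSubsets X))
∈-allSubsets {suc n} (inside ∷ X) =
  ∈-++⁺ʳ (List.map (outside ∷_) (allSubsets n)) (∈-map⁺ (inside ∷_) (∈-allSubsets X))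

any-true : ∀ (p : A → Bool) {z zs} → z ∈ₗ zs → p z ≡ true → any p zs ≡ true
any-true p (Any.here refl)      eq rewrite eq = refl
any-true p (Any.there {x} z∈zs) eq rewrite any-true p z∈zs eq = ∨-zeroʳ (p x)

any-false : ∀ (p : A → Bool) zs → (∀ z → p z ≡ false) → any p zs ≡ false
any-false p []       h = refl
any-false p (z ∷ zs) h = cong₂ _∨_ (h z) (any-false p zs h)

∧-trueˡ : ∀ {a b} → a ∧ b ≡ true → a ≡ true
∧-trueˡ {true} _ = refl

∧-trueʳ : ∀ {a b} → a ∧ b ≡ true → b ≡ true
∧-trueʳ {true} eq = eq

maxSS-maximal : ∀ (D : SetSystem n) {Y} → maxSS D Y ≡ true →
  D Y ≡ true × (∀ Z → D Z ≡ true → ¬ Y ⊂ Z)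
maxSS-maximal D {Y} eq = ∧-trueˡ eq , λ Z DZ Y⊂Z → true≢false
  (any-true (λ Z → D Z ∧ ⌊ Y ⊂? Z ⌋) (∈-allSubsets Z) (cong₂ _∧_ DZ (⌊⌋-true (Y ⊂? Z) Y⊂Z)))
  (trans (sym (not-involutive _)) (cong not (∧-trueʳ {D Y} eq)))

largest⇒maxSS : ∀ (D : SetSystem n) {Y} → Largest D Y → maxSS D Y ≡ true
largest⇒maxSS D {Y} (DY , largest) =
  cong₂ (λ a b → a ∧ not b) DY (any-false _ (allSubsets _) none)
  where
  none : ∀ Z → D Z ∧ ⌊ Y ⊂? Z ⌋ ≡ false
  none Z with D Z in eq
  ... | false = refl
  ... | true  = ⌊⌋-false (Y ⊂? Z) λ Y⊂Z → ℕ.<⇒≱ (p⊂q⇒∣p∣<∣q∣ Y⊂Z) (largest Z eq)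

Avoids : SetSystem n → Fin n → Set
Avoids D v = ∃ λ X → Largest D X × lookup X v ≡ false

-- Subsets can be searched, which turns the negated universal statement into a witness;
-- `maximal⇒largest` then replaces maximality under inclusion by maximality in size.
¬coloop⇒avoids : ∀ {D : SetSystem n} → IsDeltaMatroid D → ∀ {v} → ¬ IsColoop (maxSS D) v → Avoids D v
¬coloop⇒avoids {D = D} isΔ {v} ¬coloop
  with anySubset? (λ Y → (maxSS D Y Bool.≟ true) ×-dec (lookup Y v Bool.≟ false))
... | yes (Y , Y-max , v∉Y) =
  let DY , maximal = maxSS-maximal D Y-max in Y , maximal⇒largest isΔ Y DY maximal , v∉Y
... | no none = contradiction (λ Y Y-max → lookup⇒[]= v Y (v∈ Y Y-max)) ¬coloop
  where
  v∈ : ∀ Y → maxSS D Y ≡ true → lookup Y v ≡ true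
  v∈ Y Y-max with lookup Y v in eq
  ... | true  = refl
  ... | false = contradiction (Y , Y-max , eq) none

avoids⇒¬coloop : ∀ {D : SetSystem n} {v} → Avoids D v → ¬ IsColoop (maxSS D) v
avoids⇒¬coloop {D = D} (X , X-largest , v∉X) coloop =
  true≢false ([]=⇒lookup (coloop X (largest⇒maxSS D X-largest))) v∉X

largest-exists : ∀ {D : SetSystem n} → Proper D → ∃ (Largest D)
largest-exists {n} {D} (Y , DY) = go n Y (ℕ.m≤m+n n _) DY
  where
  -- `k` bounds by how much a member can still exceed `X`; each improvement uses up at least one
  -- unit.
  go : ∀ k X → n ≤ k ℕ.+ ∣ X ∣ → D X ≡ true → ∃ (Largest D)
  go k X n≤ DX with anySubset? (λ Z → (D Z Bool.≟ true) ×-dec (∣ X ∣ ℕ.<? ∣ Z ∣))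
  ... | no none = X , DX , λ Z DZ → ℕ.≮⇒≥ (λ X<Z → none (Z , DZ , X<Z))
  go zero    X n≤ DX | yes (Z , DZ , X<Z) =
    contradiction (ℕ.≤-trans (∣p∣≤n Z) n≤) (ℕ.<⇒≱ X<Z)
  go (suc k) X n≤ DX | yes (Z , DZ , X<Z) =
    go k Z (ℕ.≤-trans n≤ (ℕ.≤-trans (ℕ.≤-reflexive (sym (ℕ.+-suc k _))) (ℕ.+-monoʳ-≤ k X<Z))) DZ

Bounded : Fin n → (Subset n → Bool) → ℕ → Set
Bounded v E k = ∀ Z → lookup Z v ≡ false → E Z ≡ true → ∣ Z ∣ ≤ k

-- If all largest members contain `v`, removing `v` from one of them gives a largest set `X` of the
-- contraction. The deletion has none larger, because a set of size `∣ X ∣ + 1` avoiding `v` would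
-- itself be a largest member.
avoids⊎dominated : ∀ {D : SetSystem n} → Proper D → ∀ v → Avoids D v ⊎
  ∃ λ X → lookup X v ≡ false × D (toggle X v) ≡ true ×
          Bounded v D ∣ X ∣ × Bounded v (λ Z → D (toggle Z v)) ∣ X ∣
avoids⊎dominated {D = D} proper v with largest-exists proper
... | X , DX , largest
  with anySubset? (λ Z → (lookup Z v Bool.≟ false) ×-dec (D Z Bool.≟ true) ×-dec (∣ Z ∣ ℕ.≟ ∣ X ∣))
...   | yes (Z , v∉Z , DZ , eq) =
  inj₁ (Z , (DZ , λ W DW → subst (∣ W ∣ ≤_) (sym eq) (largest W DW)) , v∉Z)
...   | no none with lookup X v in Xv
...     | false = contradiction (X , Xv , DX , refl) none
...     | true  = inj₂ (toggle X v , toggle-on X v Xv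
  , subst (λ W → D W ≡ true) (sym (toggle-involutive X v)) DX
  , (λ Z v∉Z DZ → s≤s⁻¹ (subst (suc ∣ Z ∣ ≤_) (sym card)
       (ℕ.≤∧≢⇒< (largest Z DZ) (λ eq → none (Z , v∉Z , DZ , eq)))))
  , (λ Z v∉Z DZ → s≤s⁻¹ (subst (_≤ suc ∣ toggle X v ∣) (∣toggle∣-out Z v v∉Z)
       (subst (∣ toggle Z v ∣ ≤_) (sym card) (largest (toggle Z v) DZ)))))
  where
  card : suc ∣ toggle X v ∣ ≡ ∣ X ∣
  card = ∣toggle∣-in X v Xv

-- The maximum cardinalities of the three minors at v are not all equal

-- The sets `W △ {y}` and `W △ {x, v}` differ exactly in `x`, `y` and `v`. An exchange at `v` could
-- only produce `W △ {y, v}`, `W △ {v}` or `W △ {x, y, v}`, and all three are absent.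
no-fork : ∀ {D : SetSystem n} → IsDeltaMatroid D → ∀ W {x y v} → x ≢ y → x ≢ v → y ≢ v →
  D (toggle W y) ≡ true → D (toggle (toggle W x) v) ≡ true →
  D (toggle (toggle W y) v) ≡ false → D (toggle W v) ≡ false →
  ¬ D (toggle (toggle (toggle W x) y) v) ≡ false
no-fork {D = D} isΔ W {x} {y} {v} x≢y x≢v y≢v Wy Wxv ¬Wyv ¬Wv ¬Wxyv =
  by-exchange (exchange isΔ (toggle W y) (toggle (toggle W x) v) v Wy Wxv differ)
  where
  differ : lookup (toggle W y) v ≢ lookup (toggle (toggle W x) v) v
  differ rewrite toggle-self (toggle W x) v | toggle-other W (≢-sym x≢v) | toggle-other W (≢-sym y≢v)
    with lookup W v
  ... | true  = λ ()
  ... | false = λ ()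
  by-exchange : D (toggle (toggle W y) v) ≡ true ⊎
    (∃ λ u → u ≢ v × lookup (toggle W y) u ≢ lookup (toggle (toggle W x) v) u ×
             D (toggle (toggle (toggle W y) v) u) ≡ true) → Empty.⊥
  by-exchange (inj₁ Wyv) = true≢false Wyv ¬Wyv
  by-exchange (inj₂ (u , u≢v , u-differs , Wyvu)) with u Fin.≟ y
  ... | yes refl = true≢false Wyvu (trans (cong D
    (trans (toggle-comm (toggle W y) (≢-sym y≢v)) (cong (λ Z → toggle Z v) (toggle-involutive W y)))) ¬Wv)
  ... | no u≢y with u Fin.≟ x
  ...   | yes refl = true≢false Wyvu (trans (cong D
    (trans (toggle-comm (toggle W y) (≢-sym x≢v)) (cong (λ Z → toggle Z v) (toggle-comm W (≢-sym x≢y))))) ¬Wxyv)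
  ...   | no u≢x = u-differs (trans (toggle-other W u≢y)
    (sym (trans (toggle-other (toggle W x) u≢v) (toggle-other W u≢x))))

Reachable-trans : {D N N′ : SetSystem n} → Reachable D N → Reachable N N′ → Reachable D N′
Reachable-trans r start       = r
Reachable-trans r (twist s X) = twist (Reachable-trans r s) X
Reachable-trans r (loopc s X) = loopc (Reachable-trans r s) X

VFSafe-⋆ : {N : SetSystem n} → VFSafe N → ∀ X → VFSafe (N ⋆ X)
VFSafe-⋆ safe X N′ r = safe N′ (Reachable-trans (twist start X) r)

VFSafe-⊕ : {N : SetSystem n} → VFSafe N → ∀ X → VFSafe (N ⊕ X)
VFSafe-⊕ safe X N′ r = safe N′ (Reachable-trans (loopc start X) r)

-- One of N, N + v and N + v + y has a fork, according to the status of W and W ∪ {v}.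
no-adjacent-transition : ∀ {N : SetSystem n} → VFSafe N → ∀ W {x y v} → x ≢ y → x ≢ v → y ≢ v →
  lookup W x ≡ false → lookup W y ≡ false → lookup W v ≡ false →
  N (toggle W x) ≡ true → N (toggle (toggle W x) v) ≡ true →
  N (toggle W y) ≡ true → N (toggle (toggle W y) v) ≡ false →
  N (toggle (toggle W x) y) ≡ false → ¬ N (toggle (toggle (toggle W x) y) v) ≡ false
no-adjacent-transition {N = N} safe W {x} {y} {v} x≢y x≢v y≢v x∉W y∉W v∉W Nx Nxv Ny ¬Nyv ¬Nxy ¬Nxyv
  with N (toggle W v) in Wv | N W in W∅
... | false | _ = no-fork (safe N start) W x≢y x≢v y≢v Ny Nxv ¬Nyv Wv ¬Nxyv
-- Loop complementation at `v` moves the possibility of adding `v` from `W ∪ {x}` to `W ∪ {y}`, so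
-- `x` and `y` trade places in the fork. As `W` is a member, `W ∪ {v}` disappears.
... | true | true = no-fork (safe _ (loopc start ⁅ v ⁆)) W (≢-sym x≢y) y≢v x≢v
  (trans (out (toggle W x) v∉Wx) Nx)
  (trans (in′ (toggle W y) v∉Wy) (cong₂ _xor_ Ny ¬Nyv))
  (trans (in′ (toggle W x) v∉Wx) (cong₂ _xor_ Nx Nxv))
  (trans (in′ W v∉W) (cong₂ _xor_ W∅ Wv))
  (trans (cong (λ Z → (N ⊕ ⁅ v ⁆) (toggle Z v)) (toggle-comm W (≢-sym x≢y)))
         (trans (in′ (toggle (toggle W x) y) v∉Wxy) (cong₂ _xor_ ¬Nxy ¬Nxyv)))
  where
  out = ⊕⁅⁆-out N v
  in′ = ⊕⁅⁆-in N v
  v∉Wx = toggle-off W (≢-sym x≢v) v∉W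
  v∉Wy = toggle-off W (≢-sym y≢v) v∉W
  v∉Wxy = toggle-off (toggle W x) (≢-sym y≢v) v∉Wx
-- Here `W ∪ {v}` remains in `N + v`. Complementing at `y` as well removes `W ∪ {y, v}` and adds
-- `W ∪ {x, y}`, which gives a fork based at `W ∪ {y}`.
... | true | false = no-fork (safe _ (loopc (loopc start ⁅ v ⁆) ⁅ y ⁆)) (toggle W y) (≢-sym x≢y) y≢v x≢v
  (trans (cong N₂ (toggle-comm W (≢-sym x≢y)))
    (trans (⊕⁅⁆-in N₁ y (toggle W x) y∉Wx) (cong₂ _xor_ (trans (out (toggle W x) v∉Wx) Nx)
                                                        (trans (out (toggle (toggle W x) y) v∉Wxy) ¬Nxy))))
  (trans (cong (λ Z → N₂ (toggle Z v)) (toggle-involutive W y))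
    (trans (⊕⁅⁆-out N₁ y (toggle W v) (toggle-off W y≢v y∉W)) N₁Wv))
  (trans (cong N₂ (trans (cong (λ Z → toggle Z v) (toggle-comm W (≢-sym x≢y))) (toggle-comm (toggle W x) y≢v)))
    (trans (⊕⁅⁆-in N₁ y (toggle (toggle W x) v) y∉Wxv) (cong₂ _xor_ N₁Wxv
      (trans (cong N₁ (toggle-comm (toggle W x) (≢-sym y≢v)))
        (trans (in′ (toggle (toggle W x) y) v∉Wxy) (cong₂ _xor_ ¬Nxy ¬Nxyv))))))
  (trans (cong N₂ (toggle-comm W y≢v))
    (trans (⊕⁅⁆-in N₁ y (toggle W v) (toggle-off W y≢v y∉W)) (cong₂ _xor_ N₁Wv
      (trans (cong N₁ (toggle-comm W (≢-sym y≢v))) (trans (in′ (toggle W y) v∉Wy) (cong₂ _xor_ Ny ¬Nyv))))))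
  (trans (cong (λ Z → N₂ (toggle (toggle Z x) v)) (toggle-involutive W y))
    (trans (⊕⁅⁆-out N₁ y (toggle (toggle W x) v) y∉Wxv) N₁Wxv))
  where
  N₁ = N ⊕ ⁅ v ⁆
  N₂ = N₁ ⊕ ⁅ y ⁆
  out = ⊕⁅⁆-out N v
  in′ = ⊕⁅⁆-in N v
  v∉Wx = toggle-off W (≢-sym x≢v) v∉W
  v∉Wy = toggle-off W (≢-sym y≢v) v∉W
  v∉Wxy = toggle-off (toggle W x) (≢-sym y≢v) v∉Wx
  y∉Wx = toggle-off W (≢-sym x≢y) y∉W
  y∉Wxv = toggle-off (toggle W x) y≢v y∉Wx
  N₁Wv : N₁ (toggle W v) ≡ true
  N₁Wv = trans (in′ W v∉W) (cong₂ _xor_ W∅ Wv)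
  N₁Wxv : N₁ (toggle (toggle W x) v) ≡ false
  N₁Wxv = trans (in′ (toggle W x) v∉Wx) (cong₂ _xor_ Nx Nxv)

bounded-false : ∀ {v} {E : Subset n → Bool} → Bounded v E k → ∀ Z → lookup Z v ≡ false → k < ∣ Z ∣ → E Z ≡ false
bounded-false bound Z v∉Z k<Z = ≢true⇒false λ EZ → ℕ.<⇒≱ k<Z (bound Z v∉Z EZ)

-- Exchanges lead from Y to Z through members of size k; somewhere on the way, adding v becomes possible.
no-transition : ∀ {N : SetSystem n} → VFSafe N → ∀ v →
  Bounded v N k → Bounded v (λ Z → N (toggle Z v)) k → ∀ Y Z →
  lookup Y v ≡ false → N Y ≡ true → N (toggle Y v) ≡ false → ∣ Y ∣ ≡ k →
  lookup Z v ≡ false → N Z ≡ true → N (toggle Z v) ≡ true → ¬ ∣ Z ∣ ≡ k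
no-transition {n} {k} {N} safe v bound₀ bound₁ Y Z v∉Y NY ¬NYv Y≡k v∉Z NZ NZv Z≡k =
  go _ Y ℕ.≤-refl v∉Y NY ¬NYv Y≡k
  where
  go : ∀ d Y → ∣ Y △ Z ∣ ≤ d → lookup Y v ≡ false → N Y ≡ true → N (toggle Y v) ≡ false → ¬ ∣ Y ∣ ≡ k
  go d Y Y△Z≤d v∉Y NY ¬NYv Y≡k with ⊆⊎∃ Z Y
  ... | inj₁ Z⊆Y with ⊆⊎∃ Y Z
  ...   | inj₁ Y⊆Z = true≢false NZv (subst (λ U → N (toggle U v) ≡ false) (⊆-antisym Y⊆Z Z⊆Y) ¬NYv)
  ...   | inj₂ (y , Yy , Zy) = ℕ.<⇒≢ (p⊂q⇒∣p∣<∣q∣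
    (Z⊆Y , y , lookup⇒[]= y Y Yy , λ y∈Z → true≢false ([]=⇒lookup y∈Z) Zy)) (trans Z≡k (sym Y≡k))
  go d Y Y△Z≤d v∉Y NY ¬NYv Y≡k | inj₂ (x , Zx , Yx) =
    by-exchange (exchange (safe N start) Y Z x NY NZ Y≢Z)
    where
    Y≢Z : lookup Y x ≢ lookup Z x
    Y≢Z eq = true≢false (trans eq Zx) Yx
    x≢v : x ≢ v
    x≢v refl = true≢false Zx v∉Z
    v∉Yx : lookup (toggle Y x) v ≡ false
    v∉Yx = toggle-off Y (≢-sym x≢v) v∉Y
    Yx≡1+k : ∣ toggle Y x ∣ ≡ suc k
    Yx≡1+k = trans (∣toggle∣-out Y x Yx) (cong suc Y≡k)
    by-exchange : N (toggle Y x) ≡ true ⊎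
      (∃ λ y → y ≢ x × lookup Y y ≢ lookup Z y × N (toggle (toggle Y x) y) ≡ true) → Empty.⊥
    by-exchange (inj₁ NYx) = true≢false NYx
      (bounded-false bound₀ (toggle Y x) v∉Yx (ℕ.≤-reflexive (sym Yx≡1+k)))
    by-exchange (inj₂ (y , y≢x , Yy≢Zy , NYxy)) = by-status (lookup Y y) refl
      where
      y≢v : y ≢ v
      y≢v refl = Yy≢Zy (trans v∉Y (sym v∉Z))
      Yxy≢Z : lookup (toggle Y x) y ≢ lookup Z y
      Yxy≢Z eq = Yy≢Zy (trans (sym (toggle-other Y y≢x)) eq)
      Y′ = toggle (toggle Y x) y
      v∉Y′ : lookup Y′ v ≡ false
      v∉Y′ = toggle-off (toggle Y x) (≢-sym y≢v) v∉Yx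
      -- If `y` were outside `Y`, the new member would have size `k + 2`; hence `y` lies in `Y` and
      -- the exchange is a swap.
      by-status : ∀ b → lookup Y y ≡ b → Empty.⊥
      by-status false Yy = true≢false NYxy (bounded-false bound₀ Y′ v∉Y′
        (ℕ.≤-trans (ℕ.n≤1+n _) (ℕ.≤-reflexive (sym
          (trans (∣toggle∣-out (toggle Y x) y (toggle-off Y y≢x Yy)) (cong suc Yx≡1+k))))))
      by-status true Yy with N (toggle Y′ v) in Y′v
      -- From the base `Y ∖ {y}`, adding `x` gives `Y′`, adding `y` gives `Y`, and adding both gives
      -- size `k + 1`, which the bounds exclude with and without `v`.
      ... | true = no-adjacent-transition safe (toggle Y y) (≢-sym y≢x) x≢v y≢v
        (toggle-off Y (≢-sym y≢x) Yx) (toggle-on Y y Yy) (toggle-off Y (≢-sym y≢v) v∉Y)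
        (subst (λ U → N U ≡ true) Y′≡ NYxy)
        (subst (λ U → N (toggle U v) ≡ true) Y′≡ Y′v)
        (subst (λ U → N U ≡ true) (sym (toggle-involutive Y y)) NY)
        (subst (λ U → N (toggle U v) ≡ false) (sym (toggle-involutive Y y)) ¬NYv)
        (subst (λ U → N U ≡ false) Yx≡ (bounded-false bound₀ (toggle Y x) v∉Yx (ℕ.≤-reflexive (sym Yx≡1+k))))
        (subst (λ U → N (toggle U v) ≡ false) Yx≡ (bounded-false bound₁ (toggle Y x) v∉Yx (ℕ.≤-reflexive (sym Yx≡1+k))))
        where
        Y′≡ : Y′ ≡ toggle (toggle Y y) x
        Y′≡ = toggle-comm Y (≢-sym y≢x)
        Yx≡ : toggle Y x ≡ toggle (toggle (toggle Y y) x) y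
        Yx≡ = sym (trans (cong (λ U → toggle U y) (sym Y′≡)) (toggle-involutive (toggle Y x) y))
      ... | false = recurse d Y△Z≤d
        where
        closer : suc (suc ∣ Y′ △ Z ∣) ≡ ∣ Y △ Z ∣
        closer = trans (cong suc (∣△∣-toggle (toggle Y x) Z y Yxy≢Z)) (∣△∣-toggle Y Z x Y≢Z)
        recurse : ∀ d → ∣ Y △ Z ∣ ≤ d → Empty.⊥
        recurse zero    Y△Z≤0 = contradiction (ℕ.≤-trans (ℕ.≤-reflexive closer) Y△Z≤0) λ ()
        recurse (suc d) Y△Z≤1+d = go d Y′
          (ℕ.≤-trans (ℕ.n≤1+n _) (s≤s⁻¹ (ℕ.≤-trans (ℕ.≤-reflexive closer) Y△Z≤1+d)))
          v∉Y′ NYxy Y′v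
          (ℕ.suc-injective (trans (∣toggle∣-in (toggle Y x) y (toggle-off Y y≢x Yy)) Yx≡1+k))

-- The minor N∖v, the minor N/v and their symmetric difference (N + v)/v, as predicates on sets avoiding v.
module Minors (N : SetSystem n) (v : Fin n) where

  del con sum : Subset n → Bool
  del Y = N Y
  con Y = N (toggle Y v)
  sum Y = del Y xor con Y

  ⋆-del : ∀ Y → (N ⋆ ⁅ v ⁆) Y ≡ con Y
  ⋆-del = ⋆⁅⁆ N v

  ⋆-con : ∀ Y → (N ⋆ ⁅ v ⁆) (toggle Y v) ≡ del Y
  ⋆-con Y = trans (⋆⁅⁆ N v (toggle Y v)) (cong N (toggle-involutive Y v))

  ⊕-del : ∀ Y → lookup Y v ≡ false → (N ⊕ ⁅ v ⁆) Y ≡ del Y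
  ⊕-del Y = ⊕⁅⁆-out N v Y

  ⊕-con : ∀ Y → lookup Y v ≡ false → (N ⊕ ⁅ v ⁆) (toggle Y v) ≡ sum Y
  ⊕-con Y = ⊕⁅⁆-in N v Y

  Level : ℕ → (Subset n → Bool) → Set
  Level k E = ∃ λ Y → lookup Y v ≡ false × E Y ≡ true × ∣ Y ∣ ≡ k

  -- As `sum` is the symmetric difference of the other two, a set lies in none or in exactly two of
  -- the three minors. If all three had sets of size `k`, two different pairs of minors would occur,
  -- and these share one minor. A suitable sequence of operations at `v` makes the shared minor the
  -- deletion, where `no-transition` applies.
  not-all-level : VFSafe N → Bounded v del k → Bounded v con k →
    Level k del → Level k con → ¬ Level k sum
  not-all-level {k} safe bound₀ bound₁ (Y , v∉Y , dY , Y≡k) (X , v∉X , cX , X≡k) (Z , v∉Z , sZ , Z≡k)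
    with del X in dX | con Y in cY | del Z in dZ | con Z in cZ
  ... | true  | false | _ | _ = no-transition safe v bound₀ bound₁ Y X v∉Y dY cY Y≡k v∉X dX cX X≡k
  ... | true  | true  | true  | false = no-transition safe v bound₀ bound₁ Z Y v∉Z dZ cZ Z≡k v∉Y dY cY Y≡k
  ... | _     | true  | false | true  = no-transition (VFSafe-⋆ safe ⁅ v ⁆) v
    (λ W v∉W e → bound₁ W v∉W (trans (sym (⋆-del W)) e)) (λ W v∉W e → bound₀ W v∉W (trans (sym (⋆-con W)) e))
    Z Y v∉Z (trans (⋆-del Z) cZ) (trans (⋆-con Z) dZ) Z≡k
    v∉Y (trans (⋆-del Y) cY) (trans (⋆-con Y) dY) Y≡k
  ... | false | true  | _ | _ = no-transition (VFSafe-⋆ safe ⁅ v ⁆) v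
    (λ W v∉W e → bound₁ W v∉W (trans (sym (⋆-del W)) e)) (λ W v∉W e → bound₀ W v∉W (trans (sym (⋆-con W)) e))
    X Y v∉X (trans (⋆-del X) cX) (trans (⋆-con X) dX) X≡k
    v∉Y (trans (⋆-del Y) cY) (trans (⋆-con Y) dY) Y≡k
  ... | false | false | _ | _ = no-transition (VFSafe-⋆ (VFSafe-⊕ safe ⁅ v ⁆) ⁅ v ⁆) v
    (λ W v∉W e → bound-sum W v∉W (trans (sym (N₂-del W v∉W)) e))
    (λ W v∉W e → bound₀ W v∉W (trans (sym (N₂-con W v∉W)) e))
    X Y v∉X (trans (N₂-del X v∉X) (cong₂ _xor_ dX cX)) (trans (N₂-con X v∉X) dX) X≡k
    v∉Y (trans (N₂-del Y v∉Y) (cong₂ _xor_ dY cY)) (trans (N₂-con Y v∉Y) dY) Y≡k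
    where
    N₂ = (N ⊕ ⁅ v ⁆) ⋆ ⁅ v ⁆
    N₂-del : ∀ W → lookup W v ≡ false → N₂ W ≡ sum W
    N₂-del W v∉W = trans (⋆⁅⁆ (N ⊕ ⁅ v ⁆) v W) (⊕-con W v∉W)
    N₂-con : ∀ W → lookup W v ≡ false → N₂ (toggle W v) ≡ del W
    N₂-con W v∉W = trans (⋆⁅⁆ (N ⊕ ⁅ v ⁆) v (toggle W v))
      (trans (cong (N ⊕ ⁅ v ⁆) (toggle-involutive W v)) (⊕-del W v∉W))
    bound-sum : Bounded v sum k
    bound-sum W v∉W e with del W in dW
    ... | true  = bound₀ W v∉W dW
    ... | false = bound₁ W v∉W e

  -- A member containing `v` is no larger than `X`, so removing `v` from it leaves strictly less:
  -- the deletion exceeds the contraction in size.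
  avoids⇒gap : ∀ {D : SetSystem n} → Avoids D v → ∃ λ X → lookup X v ≡ false × D X ≡ true ×
    (∀ Z → D Z ≡ true → ∣ Z ∣ ≤ ∣ X ∣) ×
    (∀ Z → lookup Z v ≡ false → D (toggle Z v) ≡ true → ∣ Z ∣ < ∣ X ∣)
  avoids⇒gap (X , (DX , largest) , v∉X) = X , v∉X , DX , largest ,
    λ Z v∉Z DZ → subst (_≤ ∣ X ∣) (∣toggle∣-out Z v v∉Z) (largest (toggle Z v) DZ)

  avoids-del-con : Avoids N v → ¬ Avoids (N ⋆ ⁅ v ⁆) v
  avoids-del-con R Q with avoids⇒gap R | avoids⇒gap Q
  ... | X , v∉X , dX , _ , con< | Y , v∉Y , cY , _ , del< = ℕ.<-asym
    (con< Y v∉Y (trans (sym (⋆-del Y)) cY)) (del< X v∉X (trans (⋆-con X) dX))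

  -- At the maximum size of the deletion the contraction has no member, so `X` lies in the sum too,
  -- and the deletion cannot exceed the sum.
  avoids-del-sum : Avoids N v → ¬ Avoids (N ⊕ ⁅ v ⁆) v
  avoids-del-sum R P with avoids⇒gap R | avoids⇒gap P
  ... | X , v∉X , dX , del≤ , con< | Y , v∉Y , dY , del≤′ , sum<
    with trans (sym (⊕-del Y v∉Y)) dY | con X in cX
  ... | dY′ | true  = ℕ.<-irrefl refl (con< X v∉X cX)
  ... | dY′ | false = ℕ.<⇒≱ (sum< X v∉X (trans (⊕-con X v∉X) (cong₂ _xor_ dX cX))) (del≤ Y dY′)

  -- The set `X` of the contraction is too large for the deletion, so it lies in the sum. Then `Y`
  -- in the deletion would be both larger and smaller than `X`.
  avoids-con-sum : Avoids (N ⋆ ⁅ v ⁆) v → ¬ Avoids (N ⊕ ⁅ v ⁆) v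
  avoids-con-sum Q P with avoids⇒gap Q | avoids⇒gap P
  ... | X , v∉X , cX , _ , del< | Y , v∉Y , dY , _ , sum< with del X in dX
  ... | true  = ℕ.<-irrefl refl (del< X v∉X (trans (⋆-con X) dX))
  ... | false = ℕ.<-asym
    (del< Y v∉Y (trans (⋆-con Y) (trans (sym (⊕-del Y v∉Y)) dY)))
    (sum< X v∉X (trans (⊕-con X v∉X) (cong₂ _xor_ dX (trans (sym (⋆-del X)) cX))))

  exactlyOne-avoids : VFSafe N → ExactlyOne (Avoids (N ⊕ ⁅ v ⁆) v) (Avoids (N ⋆ ⁅ v ⁆) v) (Avoids N v)
  exactlyOne-avoids safe
    with avoids⊎dominated (proj₁ (safe _ (loopc start ⁅ v ⁆))) v
       | avoids⊎dominated (proj₁ (safe _ (twist start ⁅ v ⁆))) v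
       | avoids⊎dominated (proj₁ (safe N start)) v
  ... | inj₁ P | _ | _ = inj₁ (P , (λ Q → avoids-con-sum Q P) , (λ R → avoids-del-sum R P))
  ... | inj₂ _ | inj₁ Q | _ = inj₂ (inj₁ (avoids-con-sum Q , Q , λ R → avoids-del-con R Q))
  ... | inj₂ _ | inj₂ _ | inj₁ R = inj₂ (inj₂ (avoids-del-sum R , avoids-del-con R , R))
  -- The maxima of `del` and `con` bound each other. The maximum of `sum` is at least that of `del`
  -- and at most the larger of the two, so all three equal `∣ X ∣`.
  ... | inj₂ (Z , v∉Z , sZ , del≤Z , sum≤Z) | inj₂ (Y , v∉Y , dY , con≤Y , del≤Y)
      | inj₂ (X , v∉X , cX , del≤X , con≤X) = contradiction
    (Z , v∉Z , sZ′ , ℕ.≤-antisym Z≤X (ℕ.≤-trans X≤Y (del≤Z Y v∉Y (trans (⊕-del Y v∉Y) dY′))))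
    (not-all-level safe del≤X con≤X
      (Y , v∉Y , dY′ , ℕ.≤-antisym (del≤X Y v∉Y dY′) X≤Y) (X , v∉X , cX , refl))
    where
    dY′ : del Y ≡ true
    dY′ = trans (sym (⋆-con Y)) dY
    sZ′ : sum Z ≡ true
    sZ′ = trans (sym (⊕-con Z v∉Z)) sZ
    X≤Y : ∣ X ∣ ≤ ∣ Y ∣
    X≤Y = con≤Y X v∉X (trans (⋆-del X) cX)
    Z≤X : ∣ Z ∣ ≤ ∣ X ∣
    Z≤X with del Z in dZ
    ... | true  = del≤X Z v∉Z dZ
    ... | false = con≤X Z v∉Z (trans (sym (cong (_xor con Z) dZ)) sZ′)

-- The symplectic form on pairs of subsets

parity : Subset n → Bool
parity []      = false
parity (x ∷ X) = x xor parity X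

dot : Subset n → Subset n → Bool
dot X Y = parity (X ∩ Y)

parity-△ : ∀ (X Y : Subset n) → parity (X △ Y) ≡ parity X xor parity Y
parity-△ []      []      = refl
parity-△ (x ∷ X) (y ∷ Y) =
  trans (cong ((x xor y) xor_) (parity-△ X Y)) (interchange x y (parity X) (parity Y))

parity-zero : ∀ (X : Subset n) → (∀ i → lookup X i ≡ false) → parity X ≡ false
parity-zero []      h = refl
parity-zero (x ∷ X) h = cong₂ _xor_ (h zero) (parity-zero X (h ∘ suc))

parity-single : ∀ (X : Subset n) i → (∀ j → j ≢ i → lookup X j ≡ false) → parity X ≡ lookup X i
parity-single (x ∷ X) zero    h =
  trans (cong (x xor_) (parity-zero X (λ j → h (suc j) λ ()))) (xor-identityʳ x)
parity-single (x ∷ X) (suc i) h =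
  cong₂ _xor_ (h zero λ ()) (parity-single X i (λ j j≢i → h (suc j) (j≢i ∘ Fin.suc-injective)))

∩-lookup : ∀ (X Y : Subset n) i → lookup (X ∩ Y) i ≡ lookup X i ∧ lookup Y i
∩-lookup X Y i = lookup-zipWith _∧_ i X Y

∩-distribʳ-△ : ∀ (X Y Z : Subset n) → (X △ Y) ∩ Z ≡ (X ∩ Z) △ (Y ∩ Z)
∩-distribʳ-△ []      []      []      = refl
∩-distribʳ-△ (x ∷ X) (y ∷ Y) (z ∷ Z) = cong₂ _∷_ (∧-distribʳ-xor z x y) (∩-distribʳ-△ X Y Z)

dot-△ˡ : ∀ (X Y Z : Subset n) → dot (X △ Y) Z ≡ dot X Z xor dot Y Z
dot-△ˡ X Y Z = trans (cong parity (∩-distribʳ-△ X Y Z)) (parity-△ (X ∩ Z) (Y ∩ Z))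

dot-comm : ∀ (X Y : Subset n) → dot X Y ≡ dot Y X
dot-comm X Y = cong parity (∩-comm X Y)

dot-△ʳ : ∀ (X Y Z : Subset n) → dot X (Y △ Z) ≡ dot X Y xor dot X Z
dot-△ʳ X Y Z = trans (dot-comm X (Y △ Z))
  (trans (dot-△ˡ Y Z X) (cong₂ _xor_ (dot-comm Y X) (dot-comm Z X)))

⊥-lookup : ∀ (i : Fin n) → lookup ⊥ i ≡ false
⊥-lookup i = lookup-replicate i false

dot-⊥ʳ : ∀ (X : Subset n) → dot X ⊥ ≡ false
dot-⊥ʳ X = parity-zero (X ∩ ⊥) λ i →
  trans (∩-lookup X ⊥ i) (trans (cong (lookup X i ∧_) (⊥-lookup i)) (∧-zeroʳ _))

dot-⊥ˡ : ∀ (X : Subset n) → dot ⊥ X ≡ false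
dot-⊥ˡ X = trans (dot-comm ⊥ X) (dot-⊥ʳ X)

dot-⁅⁆ : ∀ (X : Subset n) i → dot X ⁅ i ⁆ ≡ lookup X i
dot-⁅⁆ X i = trans (parity-single (X ∩ ⁅ i ⁆) i λ j j≢i →
    trans (∩-lookup X ⁅ i ⁆ j) (trans (cong (lookup X j ∧_) (⁅⁆-other j≢i)) (∧-zeroʳ _)))
  (trans (∩-lookup X ⁅ i ⁆ i) (trans (cong (lookup X i ∧_) (⁅⁆-self i)) (∧-identityʳ _)))

Pair : ℕ → Set
Pair n = Subset n × Subset n

_⊞_ : Pair n → Pair n → Pair n
(x , y) ⊞ (x′ , y′) = x △ x′ , y △ y′

ω : Pair n → Pair n → Bool
ω (x , y) (x′ , y′) = dot x y′ xor dot y x′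

-- The contribution of `j` to `ω`: the determinant over GF(2) of the two components at `j`.
ωat : Pair n → Pair n → Fin n → Bool
ωat (x , y) (x′ , y′) j = (lookup x j ∧ lookup y′ j) xor (lookup y j ∧ lookup x′ j)

ω-⊞ˡ : ∀ (p q r : Pair n) → ω (p ⊞ q) r ≡ ω p r xor ω q r
ω-⊞ˡ (x , y) (x′ , y′) (u , w) =
  trans (cong₂ _xor_ (dot-△ˡ x x′ w) (dot-△ˡ y y′ u)) (interchange (dot x w) (dot x′ w) (dot y u) (dot y′ u))

ω-⊞ʳ : ∀ (p q r : Pair n) → ω p (q ⊞ r) ≡ ω p q xor ω p r
ω-⊞ʳ (x , y) (u , w) (u′ , w′) =
  trans (cong₂ _xor_ (dot-△ʳ x w w′) (dot-△ʳ y u u′)) (interchange (dot x w) (dot x w′) (dot y u) (dot y u′))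

△-cancelʳ : ∀ (X Y : Subset n) → (X △ Y) △ Y ≡ X
△-cancelʳ []      []      = refl
△-cancelʳ (x ∷ X) (y ∷ Y) =
  cong₂ _∷_ (trans (xor-assoc x y y) (trans (cong (x xor_) (xor-same y)) (xor-identityʳ x))) (△-cancelʳ X Y)

⊥⊎∃ : ∀ (X : Subset n) → X ≡ ⊥ ⊎ ∃ λ i → lookup X i ≡ true
⊥⊎∃ X with Fin.any? (λ i → lookup X i Bool.≟ true)
... | yes p = inj₂ p
... | no ¬p = inj₁ (lookup-ext λ i → trans (≢true⇒false (λ eq → ¬p (i , eq))) (sym (⊥-lookup i)))

-- Finite-dimensional duality without bases or dimensions: all pairs are listed, and orthogonality
-- to those in `U` is imposed one vector at a time.
separate : (U : Pair n → Set) → (∀ p → Dec (U p)) → U (⊥ , ⊥) → (∀ {p q} → U p → U q → U (p ⊞ q)) →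
  ∀ t → U t ⊎ ∃ λ p → (∀ u → U u → ω p u ≡ false) × ω p t ≡ true
separate {n} U U? U⊥ U⊞ t with go (List.cartesianProduct (allSubsets n) (allSubsets n)) t
  where
  go : ∀ (S : List (Pair n)) t →
    U t ⊎ ∃ λ p → (∀ u → u ∈ₗ S → U u → ω p u ≡ false) × ω p t ≡ true
  go [] (x , y) with ⊥⊎∃ x | ⊥⊎∃ y
  ... | inj₁ refl | inj₁ refl = inj₁ U⊥
  ... | inj₂ (i , xi) | _ = inj₂ ((⊥ , ⁅ i ⁆) , (λ _ ()) ,
    cong₂ _xor_ (dot-⊥ˡ y) (trans (dot-comm ⁅ i ⁆ x) (trans (dot-⁅⁆ x i) xi)))
  ... | inj₁ refl | inj₂ (i , yi) = inj₂ ((⁅ i ⁆ , ⊥) , (λ _ ()) ,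
    cong₂ _xor_ (trans (dot-comm ⁅ i ⁆ y) (trans (dot-⁅⁆ y i) yi)) (dot-⊥ˡ {n} ⊥))
  go (s ∷ S) t with U? s
  ... | no ¬Us with go S t
  ...   | inj₁ Ut = inj₁ Ut
  ...   | inj₂ (p , p⊥S , pt) = inj₂ (p , (λ where
    u (Any.here refl) Uu → contradiction Uu ¬Us
    u (Any.there u∈S) Uu → p⊥S u u∈S Uu) , pt)
  -- Both `t` and `t ⊞ s` are tested against the shorter list. If neither separating vector is
  -- orthogonal to `s`, their sum is; it still separates `t`, because `q` is then orthogonal to `t`.
  go (s ∷ S) t | yes Us with go S t | go S (t ⊞ s)
  ... | inj₁ Ut | _ = inj₁ Ut
  ... | _ | inj₁ Uts = inj₁ (subst U (cong₂ _,_ (△-cancelʳ _ _) (△-cancelʳ _ _)) (U⊞ Uts Us))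
  ... | inj₂ (p , p⊥S , pt) | inj₂ (q , q⊥S , qts) with ω p s in ps | ω q s in qs
  ...   | false | _ = inj₂ (p , (λ where
    u (Any.here refl) _ → ps
    u (Any.there u∈S) Uu → p⊥S u u∈S Uu) , pt)
  ...   | true | false = inj₂ (q , (λ where
    u (Any.here refl) _ → qs
    u (Any.there u∈S) Uu → q⊥S u u∈S Uu)
    , trans (sym (trans (cong (ω q t xor_) qs) (xor-identityʳ _))) (trans (sym (ω-⊞ʳ q t s)) qts))
  ...   | true | true = inj₂ (p ⊞ q , (λ where
    u (Any.here refl) _ → trans (ω-⊞ˡ p q u) (cong₂ _xor_ ps qs)
    u (Any.there u∈S) Uu → trans (ω-⊞ˡ p q u) (cong₂ _xor_ (p⊥S u u∈S Uu) (q⊥S u u∈S Uu)))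
    , trans (ω-⊞ˡ p q t) (cong₂ _xor_ pt qt))
    where
    xor-true : ∀ b → b xor true ≡ true → b ≡ false
    xor-true false _ = refl
    qt : ω q t ≡ false
    qt = xor-true (ω q t) (trans (cong (ω q t xor_) (sym qs)) (trans (sym (ω-⊞ʳ q t s)) qts))
... | inj₁ Ut = inj₁ Ut
... | inj₂ (p , p⊥ , pt) =
  inj₂ (p , (λ u → p⊥ u (∈-cartesianProduct⁺ (∈-allSubsets (proj₁ u)) (∈-allSubsets (proj₂ u)))) , pt)

ω-local : ∀ (p q : Pair n) → ∃ λ Z → parity Z ≡ ω p q × (∀ j → lookup Z j ≡ ωat p q j)
ω-local (x , y) (x′ , y′) = (x ∩ y′) △ (y ∩ x′) , parity-△ (x ∩ y′) (y ∩ x′) ,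
  λ j → trans (△-lookup (x ∩ y′) (y ∩ x′) j) (cong₂ _xor_ (∩-lookup x y′ j) (∩-lookup y x′ j))

ω-single : ∀ (p q : Pair n) i → (∀ j → j ≢ i → ωat p q j ≡ false) → ω p q ≡ ωat p q i
ω-single p q i h with ω-local p q
... | Z , parity≡ω , Z≡ω = trans (sym parity≡ω)
  (trans (parity-single Z i (λ j j≢i → trans (Z≡ω j) (h j j≢i))) (Z≡ω i))

ω-double : ∀ (p q : Pair n) {v w} → v ≢ w → (∀ j → j ≢ v → j ≢ w → ωat p q j ≡ false) →
  ω p q ≡ ωat p q v xor ωat p q w
ω-double {n} p q {v} {w} v≢w h with ω-local p q
... | Z , parity≡ω , Z≡ω with ωat p q w in eq
...   | false = trans (sym parity≡ω) (trans (parity-single Z v others) (trans (Z≡ω v) (sym (xor-identityʳ _))))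
  where
  others : ∀ j → j ≢ v → lookup Z j ≡ false
  others j j≢v with j Fin.≟ w
  ... | yes refl = trans (Z≡ω j) eq
  ... | no j≢w   = trans (Z≡ω j) (h j j≢v j≢w)
...   | true = trans (sym parity≡ω) (trans (sym cancel) (cong (_xor true) Zw))
  where
  others : ∀ j → j ≢ v → lookup (Z △ ⁅ w ⁆) j ≡ false
  others j j≢v with j Fin.≟ w
  ... | yes refl = trans (△-lookup Z ⁅ w ⁆ w) (cong₂ _xor_ (trans (Z≡ω w) eq) (⁅⁆-self w))
  ... | no j≢w   = trans (△-lookup Z ⁅ w ⁆ j) (cong₂ _xor_ (trans (Z≡ω j) (h j j≢v j≢w)) (⁅⁆-other j≢w))
  Zw : parity (Z △ ⁅ w ⁆) ≡ ωat p q v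
  Zw = trans (parity-single (Z △ ⁅ w ⁆) v others)
    (trans (△-lookup Z ⁅ w ⁆ v) (trans (cong₂ _xor_ (Z≡ω v) (⁅⁆-other v≢w)) (xor-identityʳ _)))
  cancel : parity (Z △ ⁅ w ⁆) xor true ≡ parity Z
  cancel = trans (cong (parity (Z △ ⁅ w ⁆) xor_)
      (sym (trans (parity-single ⁅ w ⁆ w (λ j → ⁅⁆-other)) (⁅⁆-self w))))
    (trans (sym (parity-△ (Z △ ⁅ w ⁆) ⁅ w ⁆)) (cong parity (△-cancelʳ Z ⁅ w ⁆)))

-- Lines in the plane at one element

data Line : Set where
  x≡0 y≡0 x≡y : Line

On : Line → Bool → Bool → Set
On x≡0 x y = x ≡ false
On y≡0 x y = y ≡ false
On x≡y x y = x ≡ y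

On? : ∀ t x y → Dec (On t x y)
On? x≡0 x y = x Bool.≟ false
On? y≡0 x y = y Bool.≟ false
On? x≡y x y = x Bool.≟ y

On-0 : ∀ t → On t false false
On-0 x≡0 = refl
On-0 y≡0 = refl
On-0 x≡y = refl

On-xor : ∀ t {x y x′ y′} → On t x y → On t x′ y′ → On t (x xor x′) (y xor y′)
On-xor x≡0 refl refl = refl
On-xor y≡0 refl refl = refl
On-xor x≡y refl refl = refl

-- Vectors on a common line are proportional, so their determinant vanishes.
On-isotropic : ∀ t {x y x′ y′} → On t x y → On t x′ y′ → (x ∧ y′) xor (y ∧ x′) ≡ false
On-isotropic x≡0 {y = y} refl refl = ∧-zeroʳ y
On-isotropic y≡0 {x = x} refl refl = trans (xor-identityʳ _) (∧-zeroʳ x)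
On-isotropic x≡y {x = x} {x′ = x′} refl refl = xor-same (x ∧ x′)

-- Nonzero vectors on distinct lines are linearly independent, so their determinant is one.
On-distinct : ∀ {s t} → s ≢ t → ∀ x y x′ y′ → On s x y → On t x′ y′ →
  (x ∧ y′) xor (y ∧ x′) ≡ false → x ∨ y ≡ true → x′ ∨ y′ ≡ false
On-distinct {x≡0} {x≡0} s≢t = contradiction refl s≢t
On-distinct {x≡0} {y≡0} _ false true false false _ _ _ _ = refl
On-distinct {x≡0} {x≡y} _ false true false false _ _ _ _ = refl
On-distinct {y≡0} {x≡0} _ true false false false _ _ _ _ = refl
On-distinct {y≡0} {y≡0} s≢t = contradiction refl s≢t
On-distinct {y≡0} {x≡y} _ true false false false _ _ _ _ = refl
On-distinct {x≡y} {x≡0} _ true  _ false false _    _ _  _ = refl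
On-distinct {x≡y} {x≡0} _ true  _ false true refl _ () _
On-distinct {x≡y} {x≡0} _ false _ _ _ refl _ _ ()
On-distinct {x≡y} {y≡0} _ true  _ false false _    _ _  _ = refl
On-distinct {x≡y} {y≡0} _ true  _ true false refl _ () _
On-distinct {x≡y} {y≡0} _ false _ _ _ refl _ _ ()
On-distinct {x≡y} {x≡y} s≢t = contradiction refl s≢t

On-zero : ∀ t {x y} → x ∨ y ≡ false → On t x y
On-zero t {false} {false} _ = On-0 t

generator : Line → Fin n → Pair n
generator x≡0 j = ⊥ , ⁅ j ⁆
generator y≡0 j = ⁅ j ⁆ , ⊥
generator x≡y j = ⁅ j ⁆ , ⁅ j ⁆

generator-self : ∀ t (j : Fin n) → On t (lookup (proj₁ (generator t j)) j) (lookup (proj₂ (generator t j)) j)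
generator-self x≡0 j = ⊥-lookup j
generator-self y≡0 j = ⊥-lookup j
generator-self x≡y j = refl

generator-other : ∀ t {i j : Fin n} → i ≢ j →
  lookup (proj₁ (generator t j)) i ≡ false × lookup (proj₂ (generator t j)) i ≡ false
generator-other x≡0 {i} i≢j = ⊥-lookup i , ⁅⁆-other i≢j
generator-other y≡0 {i} i≢j = ⁅⁆-other i≢j , ⊥-lookup i
generator-other x≡y i≢j = ⁅⁆-other i≢j , ⁅⁆-other i≢j

ω-generator : ∀ t (j : Fin n) x y → ω (x , y) (generator t j) ≡ false → On t (lookup x j) (lookup y j)
ω-generator x≡0 j x y eq =
  trans (sym (trans (cong₂ _xor_ (dot-⁅⁆ x j) (dot-⊥ʳ y)) (xor-identityʳ _))) eq
ω-generator y≡0 j x y eq = trans (sym (cong₂ _xor_ (dot-⊥ʳ x) (dot-⁅⁆ y j))) eq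
ω-generator x≡y j x y eq with trans (sym (cong₂ _xor_ (dot-⁅⁆ x j) (dot-⁅⁆ y j))) eq
... | xor≡ with lookup x j | lookup y j
...   | true  | true  = refl
...   | false | false = refl

basisLine fundamentalLine : Bool → Line
basisLine false = y≡0
basisLine true  = x≡0
fundamentalLine false = y≡0
fundamentalLine true  = x≡y

-- At each element of `Y`, loop complementation adds up the two minors, and `G-xor` says that this
-- replaces the line `x≡0` by `x≡y`.
⊕-full : ∀ (D : SetSystem n) (G : Vec Line n → Bool) →
  (∀ T i → G (T [ i ]≔ y≡0) xor G (T [ i ]≔ x≡0) ≡ G (T [ i ]≔ x≡y)) →
  (∀ Y → D Y ≡ G (Vec.map basisLine Y)) → ∀ Y → (D ⊕ full n) Y ≡ G (Vec.map fundamentalLine Y)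
⊕-full D G G-xor D≡G [] = trans (⊕-[] D) (D≡G [])
⊕-full {suc n} D G G-xor D≡G (outside ∷ Y) = trans (⊕-out D (full n) Y inside)
  (⊕-full (slice D outside) (λ T → G (y≡0 ∷ T)) (λ T i → G-xor (y≡0 ∷ T) (suc i)) (λ Z → D≡G (outside ∷ Z)) Y)
⊕-full {suc n} D G G-xor D≡G (inside ∷ Y) = trans (⊕-in D (full n) Y) (trans (cong₂ _xor_
  (⊕-full (slice D outside) (λ T → G (y≡0 ∷ T)) (λ T i → G-xor (y≡0 ∷ T) (suc i)) (λ Z → D≡G (outside ∷ Z)) Y)
  (⊕-full (slice D inside) (λ T → G (x≡0 ∷ T)) (λ T i → G-xor (x≡0 ∷ T) (suc i)) (λ Z → D≡G (inside ∷ Z)) Y))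
  (G-xor (x≡0 ∷ Vec.map fundamentalLine Y) zero))

-- Orthogonally complementary L and K make L × K a Lagrangian subspace.
module Lagrangian (L K : Subset n → Set) (L? : ∀ x → Dec (L x)) (K? : ∀ y → Dec (K y))
  (L⊥K : ∀ {x y} → L x → K y → dot x y ≡ false)
  (L-max : ∀ x → (∀ y → K y → dot x y ≡ false) → L x)
  (K-max : ∀ y → (∀ x → L x → dot x y ≡ false) → K y) where

  L-△ : ∀ {x x′} → L x → L x′ → L (x △ x′)
  L-△ {x} {x′} Lx Lx′ = L-max _ λ y Ky → trans (dot-△ˡ x x′ y) (cong₂ _xor_ (L⊥K Lx Ky) (L⊥K Lx′ Ky))

  K-△ : ∀ {y y′} → K y → K y′ → K (y △ y′)
  K-△ {y} {y′} Ky Ky′ = K-max _ λ x Lx → trans (dot-△ʳ x y y′) (cong₂ _xor_ (L⊥K Lx Ky) (L⊥K Lx Ky′))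

  L-⊥ : L ⊥
  L-⊥ = L-max ⊥ λ y _ → dot-⊥ˡ y

  K-⊥ : K ⊥
  K-⊥ = K-max ⊥ λ x _ → dot-⊥ʳ x

  isotropic : ∀ {x y x′ y′} → L x → K y → L x′ → K y′ → ω (x , y) (x′ , y′) ≡ false
  isotropic {x} {y} {x′} Lx Ky Lx′ Ky′ =
    cong₂ _xor_ (L⊥K Lx Ky′) (trans (dot-comm y x′) (L⊥K Lx′ Ky))

  Supported : Vec Line n → Fin n → Pair n → Set
  Supported T i (x , y) = L x × K y × (∀ j → j ≢ i → On (lookup T j) (lookup x j) (lookup y j))

  -- Let `U` be the sum of L × K and the chosen lines away from `i`. If `(⁅ i ⁆ , ⊥)` lies in `U`,
  -- its part in L × K is nonzero at `i`. Otherwise some vector orthogonal to `U` pairs with it to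
  -- one; this vector lies in L × K and on the chosen lines, as these are their own orthogonal
  -- complements.
  nonzero-at : ∀ T i → ∃₂ λ x y → Supported T i (x , y) × lookup x i ∨ lookup y i ≡ true
  nonzero-at T i with separate U U? U⊥ (λ {p} {q} → U⊞ {p} {q}) (⁅ i ⁆ , ⊥)
    where
    U : Pair n → Set
    U (p , q) = ∃ λ x → ∃ λ y → L x × K y ×
      (∀ j → j ≢ i → On (lookup T j) (lookup p j xor lookup x j) (lookup q j xor lookup y j)) ×
      lookup p i ≡ lookup x i × lookup q i ≡ lookup y i
    U? : ∀ p → Dec (U p)
    U? (p , q) = anySubset? λ x → anySubset? λ y → L? x ×-dec K? y ×-dec
      Fin.all? (λ j → ¬? (j Fin.≟ i) →-dec On? (lookup T j) _ _) ×-dec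
      (lookup p i Bool.≟ lookup x i) ×-dec (lookup q i Bool.≟ lookup y i)
    U⊥ : U (⊥ , ⊥)
    U⊥ = ⊥ , ⊥ , L-⊥ , K-⊥ ,
      (λ j _ → subst (λ b → On (lookup T j) b b) (sym (xor-same (lookup ⊥ j))) (On-0 (lookup T j))) , refl , refl
    U⊞ : ∀ {p q} → U p → U q → U (p ⊞ q)
    U⊞ {p , q} {p′ , q′} (x , y , Lx , Ky , on , xi , yi) (x′ , y′ , Lx′ , Ky′ , on′ , x′i , y′i) =
      x △ x′ , y △ y′ , L-△ Lx Lx′ , K-△ Ky Ky′ ,
      (λ j j≢i → subst₂ (On (lookup T j)) (spread p p′ x x′ j) (spread q q′ y y′ j)
                        (On-xor (lookup T j) (on j j≢i) (on′ j j≢i))) ,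
      at-i p p′ x x′ xi x′i , at-i q q′ y y′ yi y′i
      where
      spread : ∀ (p p′ x x′ : Subset n) j →
        (lookup p j xor lookup x j) xor (lookup p′ j xor lookup x′ j) ≡ lookup (p △ p′) j xor lookup (x △ x′) j
      spread p p′ x x′ j = trans (interchange (lookup p j) (lookup x j) (lookup p′ j) (lookup x′ j))
        (sym (cong₂ _xor_ (△-lookup p p′ j) (△-lookup x x′ j)))
      at-i : ∀ (p p′ x x′ : Subset n) → lookup p i ≡ lookup x i → lookup p′ i ≡ lookup x′ i →
        lookup (p △ p′) i ≡ lookup (x △ x′) i
      at-i p p′ x x′ e e′ = trans (△-lookup p p′ i) (trans (cong₂ _xor_ e e′) (sym (△-lookup x x′ i)))
  ... | inj₁ (x , y , Lx , Ky , on , xi , yi) = x , y ,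
    (Lx , Ky , λ j j≢i → subst₂ (On (lookup T j)) (cong (_xor lookup x j) (⁅⁆-other j≢i))
                                (cong (_xor lookup y j) (⊥-lookup j)) (on j j≢i)) ,
    cong (_∨ lookup y i) (trans (sym xi) (⁅⁆-self i))
  ... | inj₂ ((x , y) , ⊥U , ω≡true) = x , y , (Lx , Ky , on) ,
    trans (cong (lookup x i ∨_) yi) (∨-zeroʳ _)
    where
    Lx : L x
    Lx = L-max x λ y′ Ky′ → trans (sym (trans (cong (dot x y′ xor_) (dot-⊥ʳ y)) (xor-identityʳ _)))
      (⊥U (⊥ , y′) (⊥ , y′ , L-⊥ , Ky′ , (λ j _ → subst₂ (On (lookup T j))
        (sym (xor-same (lookup ⊥ j))) (sym (xor-same (lookup y′ j))) (On-0 (lookup T j))) , refl , refl))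
    Ky : K y
    Ky = K-max y λ x′ Lx′ → trans (dot-comm x′ y) (trans (sym (cong (_xor dot y x′) (dot-⊥ʳ x)))
      (⊥U (x′ , ⊥) (x′ , ⊥ , Lx′ , K-⊥ , (λ j _ → subst₂ (On (lookup T j))
        (sym (xor-same (lookup x′ j))) (sym (xor-same (lookup ⊥ j))) (On-0 (lookup T j))) , refl , refl)))
    yi : lookup y i ≡ true
    yi = trans (sym (cong₂ _xor_ (dot-⊥ʳ x) (dot-⁅⁆ y i))) ω≡true
    on : ∀ j → j ≢ i → On (lookup T j) (lookup x j) (lookup y j)
    on j j≢i = ω-generator t j x y (⊥U (generator t j) (⊥ , ⊥ , L-⊥ , K-⊥ , on-T ,
        trans (proj₁ (generator-other t (≢-sym j≢i))) (sym (⊥-lookup i)) ,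
        trans (proj₂ (generator-other t (≢-sym j≢i))) (sym (⊥-lookup i))))
      where
      t = lookup T j
      xor-⊥ : ∀ b l → b ≡ b xor lookup {n = n} ⊥ l
      xor-⊥ b l = sym (trans (cong (b xor_) (⊥-lookup l)) (xor-identityʳ b))
      on-T : ∀ l → l ≢ i → On (lookup T l) (lookup (proj₁ (generator t j)) l xor lookup ⊥ l)
                                           (lookup (proj₂ (generator t j)) l xor lookup ⊥ l)
      on-T l _ with l Fin.≟ j
      ... | yes refl = subst₂ (On (lookup T l)) (xor-⊥ _ l) (xor-⊥ _ l) (generator-self t l)
      ... | no l≢j = subst₂ (On (lookup T l))
        (trans (sym (proj₁ (generator-other t l≢j))) (xor-⊥ _ l))
        (trans (sym (proj₂ (generator-other t l≢j))) (xor-⊥ _ l)) (On-0 (lookup T l))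

  Meets : Vec Line n → Set
  Meets T = ∃ λ x → ∃ λ y → L x × K y × (∀ j → On (lookup T j) (lookup x j) (lookup y j)) ×
    ∃ λ j → lookup x j ∨ lookup y j ≡ true

  Meets? : ∀ T → Dec (Meets T)
  Meets? T = anySubset? λ x → anySubset? λ y → L? x ×-dec K? y ×-dec
    Fin.all? (λ j → On? (lookup T j) _ _) ×-dec Fin.any? (λ j → (lookup x j ∨ lookup y j) Bool.≟ true)

  transverse : Vec Line n → Bool
  transverse T = not ⌊ Meets? T ⌋

  transverse⇒¬meets : ∀ T → transverse T ≡ true → ¬ Meets T
  transverse⇒¬meets T eq with Meets? T
  transverse⇒¬meets T () | yes _
  ... | no ¬m = ¬m

  ¬transverse⇒meets : ∀ T → transverse T ≡ false → Meets T
  ¬transverse⇒meets T eq with Meets? T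
  ... | yes m = m
  ¬transverse⇒meets T () | no _

  ¬meets⇒transverse : ∀ T → ¬ Meets T → transverse T ≡ true
  ¬meets⇒transverse T ¬m = cong not (⌊⌋-false (Meets? T) ¬m)

  On-update : ∀ (T : Vec Line n) i {t} (x y : Subset n) → (∀ j → j ≢ i → On (lookup T j) (lookup x j) (lookup y j)) →
    On t (lookup x i) (lookup y i) → ∀ j → On (lookup (T [ i ]≔ t) j) (lookup x j) (lookup y j)
  On-update T i {t} x y off on j with j Fin.≟ i
  ... | yes refl = subst (λ s → On s (lookup x i) (lookup y i)) (sym (lookup∘update i T t)) on
  ... | no j≢i   = subst (λ s → On s (lookup x j) (lookup y j)) (sym (lookup∘update′ j≢i T t)) (off j j≢i)

  meets-on : ∀ T i {t} (m : Meets (T [ i ]≔ t)) → let x , y , _ = m in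
    Supported T i (x , y) × On t (lookup x i) (lookup y i)
  meets-on T i {t} (x , y , Lx , Ky , on , _) =
    (Lx , Ky , λ j j≢i → subst (λ s → On s (lookup x j) (lookup y j)) (lookup∘update′ j≢i T t) (on j)) ,
    subst (λ s → On s (lookup x i) (lookup y i)) (lookup∘update i T t) (on i)

  -- Away from `i` both vectors lie on common lines and contribute nothing, so isotropy of L × K
  -- leaves only the term at `i`.
  Supported-ωat : ∀ T i {p q} → Supported T i p → Supported T i q → ωat p q i ≡ false
  Supported-ωat T i {x , y} {x′ , y′} (Lx , Ky , on) (Lx′ , Ky′ , on′) =
    trans (sym (ω-single (x , y) (x′ , y′) i λ j j≢i → On-isotropic (lookup T j) (on j j≢i) (on′ j j≢i)))
          (isotropic Lx Ky Lx′ Ky′)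

  some-line-meets : ∀ T i → ∃ λ t → Meets (T [ i ]≔ t)
  some-line-meets T i with nonzero-at T i
  ... | x , y , (Lx , Ky , on) , nz with line (lookup x i) (lookup y i)
    where
    line : ∀ b c → ∃ λ t → On t b c
    line false c     = x≡0 , refl
    line true  false = y≡0 , refl
    line true  true  = x≡y , refl
  ...   | t , on-t = t , x , y , Lx , Ky , On-update T i x y on on-t , i , nz

  -- At most one of the two witnesses is nonzero at `i`, by `On-distinct`. The other vanishes there
  -- and hence lies on every line at `i`.
  two-lines-meet : ∀ T i {s t} → s ≢ t → Meets (T [ i ]≔ s) → Meets (T [ i ]≔ t) → ∀ r → Meets (T [ i ]≔ r)
  two-lines-meet T i {s} {t} s≢t m@(x , y , _ , _ , _ , nz) m′@(x′ , y′ , _ , _ , _ , nz′) r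
    with meets-on T i m | meets-on T i m′ | (lookup x i ∨ lookup y i) in z
  ... | (Lx , Ky , on) , _ | _ | false =
    x , y , Lx , Ky , On-update T i x y on (On-zero r z) , nz
  ... | sup@(Lx , Ky , on) , at-i | sup′@(Lx′ , Ky′ , on′) , at-i′ | true =
    x′ , y′ , Lx′ , Ky′ , On-update T i x′ y′ on′ (On-zero r
      (On-distinct s≢t (lookup x i) (lookup y i) (lookup x′ i) (lookup y′ i) at-i at-i′ (Supported-ωat T i sup sup′) z)) , nz′

  -- By `some-line-meets` and `two-lines-meet`, one or all three of the lines at `i` are met, so two
  -- or none are transverse.
  transverse-xor : ∀ T i →
    transverse (T [ i ]≔ y≡0) xor transverse (T [ i ]≔ x≡0) ≡ transverse (T [ i ]≔ x≡y)
  transverse-xor T i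
    with Meets? (T [ i ]≔ x≡0) | Meets? (T [ i ]≔ y≡0) | Meets? (T [ i ]≔ x≡y)
  ... | yes _ | yes _ | yes _ = refl
  ... | yes _ | no _  | no _  = refl
  ... | no _  | yes _ | no _  = refl
  ... | no _  | no _  | yes _ = refl
  ... | yes a | yes b | no ¬c = contradiction (two-lines-meet T i (λ ()) a b _) ¬c
  ... | yes a | no ¬b | yes c = contradiction (two-lines-meet T i (λ ()) a c _) ¬b
  ... | no ¬a | yes b | yes c = contradiction (two-lines-meet T i (λ ()) b c _) ¬a
  ... | no ¬a | no ¬b | no ¬c with some-line-meets T i
  ...   | x≡0 , m = contradiction m ¬a
  ...   | y≡0 , m = contradiction m ¬b
  ...   | x≡y , m = contradiction m ¬c

  -- With K the cycle space, the lines `x≡0`, `y≡0` and `x≡y` give membership of `v` in P₀, Q₀ and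
  -- R₀.
  DiagonalOff : Line → Fin n → Set
  DiagonalOff t v = ∃ λ x → ∃ λ y → L x × K y × (∀ j → j ≢ v → lookup x j ≡ lookup y j) ×
    On t (lookup x v) (lookup y v) × lookup x v ∨ lookup y v ≡ true

  DiagonalOff-disjoint : ∀ {s t v} → s ≢ t → DiagonalOff s v → ¬ DiagonalOff t v
  DiagonalOff-disjoint {v = v} s≢t (x , y , Lx , Ky , diag , on , nz) (x′ , y′ , Lx′ , Ky′ , diag′ , on′ , nz′) =
    true≢false nz′ (On-distinct s≢t (lookup x v) (lookup y v) (lookup x′ v) (lookup y′ v) on on′
      (Supported-ωat (Vec.replicate n x≡y) v (Lx , Ky , on-diag x y diag) (Lx′ , Ky′ , on-diag x′ y′ diag′)) nz)
    where
    on-diag : ∀ (x y : Subset n) → (∀ j → j ≢ v → lookup x j ≡ lookup y j) →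
      ∀ j → j ≢ v → On (lookup (Vec.replicate n x≡y) j) (lookup x j) (lookup y j)
    on-diag x y diag j j≢v = subst (λ t → On t (lookup x j) (lookup y j)) (sym (lookup-replicate j x≡y)) (diag j j≢v)

  -- At `v`, the lines `s` and `t` stand for omitting and containing `v`. The set `Y ∪ {v}` is too
  -- large to be a member, so some vector lies on the lines of `Y` with `t` at `v`. On `Y` it is
  -- diagonal by the choice of lines; elsewhere off `v` it has y = 0, and the size of `Y` forces x =
  -- 0.
  avoids⇒DiagonalOff : ∀ {D : SetSystem n} {v s t} → s ≢ t →
    (∀ Y → lookup Y v ≡ false → D Y ≡ transverse (Vec.map fundamentalLine Y [ v ]≔ s)) →
    (∀ Y → lookup Y v ≡ false → D (toggle Y v) ≡ transverse (Vec.map fundamentalLine Y [ v ]≔ t)) →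
    Avoids D v → DiagonalOff t v
  avoids⇒DiagonalOff {D} {v} {s} {t} s≢t D-out D-in (Y , (DY , largest) , v∉Y) =
    x , y , Lx , Ky , diagonal , on-t , nz
    where
    lines : Subset n → Vec Line n
    lines = Vec.map fundamentalLine
    T = lines Y
    at : ∀ Z j {b} → lookup Z j ≡ b → ∀ {x y} → On (lookup (lines Z) j) x y → On (fundamentalLine b) x y
    at Z j refl {x} {y} = subst (λ t → On t x y) (lookup-map j fundamentalLine Z)
    at⁻ : ∀ Z j {b} → lookup Z j ≡ b → ∀ {x y} → On (fundamentalLine b) x y → On (lookup (lines Z) j) x y
    at⁻ Z j refl {x} {y} = subst (λ t → On t x y) (sym (lookup-map j fundamentalLine Z))
    larger : ∀ Z → ∣ Y ∣ < ∣ Z ∣ → D Z ≡ false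
    larger Z Y<Z = ≢true⇒false λ DZ → ℕ.<⇒≱ Y<Z (largest Z DZ)
    isolated : ¬ Meets (T [ v ]≔ s)
    isolated = transverse⇒¬meets (T [ v ]≔ s) (trans (sym (D-out Y v∉Y)) DY)
    ℓ : Meets (T [ v ]≔ t)
    ℓ = ¬transverse⇒meets (T [ v ]≔ t) (trans (sym (D-in Y v∉Y))
      (larger (toggle Y v) (ℕ.≤-reflexive (sym (∣toggle∣-out Y v v∉Y)))))
    x y : Subset n
    x = proj₁ ℓ
    y = proj₁ (proj₂ ℓ)
    Lx = proj₁ (proj₁ (meets-on T v ℓ))
    Ky = proj₁ (proj₂ (proj₁ (meets-on T v ℓ)))
    on-T = proj₂ (proj₂ (proj₁ (meets-on T v ℓ)))
    on-t = proj₂ (meets-on T v ℓ)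
    -- A vector vanishing at `v` would lie on `s` too, although `Y` is a member.
    nz : lookup x v ∨ lookup y v ≡ true
    nz with lookup x v ∨ lookup y v in eq
    ... | true  = refl
    ... | false = contradiction
      (x , y , Lx , Ky , On-update T v x y on-T (On-zero s eq) , proj₂ (proj₂ (proj₂ (proj₂ (proj₂ ℓ))))) isolated
    -- If x w ≡ true for some w outside Y ∪ {v}, then the vectors witnessing that Y ∪ {w} and
    -- Y ∪ {v, w} are not members cannot both be orthogonal to (x , y) and to each other.
    no-outlier : ∀ w → w ≢ v → lookup Y w ≡ false → lookup y w ≡ false → ¬ lookup x w ≡ true
    no-outlier w w≢v w∉Y yw xw = contradiction″
      where
      Y′ = toggle Y w
      v∉Y′ : lookup Y′ v ≡ false
      v∉Y′ = toggle-off Y (≢-sym w≢v) v∉Y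
      Y<Y′ : ∣ Y ∣ < ∣ Y′ ∣
      Y<Y′ = ℕ.≤-reflexive (sym (∣toggle∣-out Y w w∉Y))
      ℓ′ : Meets (lines Y′ [ v ]≔ s)
      ℓ′ = ¬transverse⇒meets (lines Y′ [ v ]≔ s) (trans (sym (D-out Y′ v∉Y′)) (larger Y′ Y<Y′))
      ℓ″ : Meets (lines Y′ [ v ]≔ t)
      ℓ″ = ¬transverse⇒meets (lines Y′ [ v ]≔ t) (trans (sym (D-in Y′ v∉Y′)) (larger (toggle Y′ v)
        (ℕ.<-trans Y<Y′ (ℕ.≤-reflexive (sym (∣toggle∣-out Y′ v v∉Y′))))))
      x′ y′ x″ y″ : Subset n
      x′ = proj₁ ℓ′
      y′ = proj₁ (proj₂ ℓ′)
      x″ = proj₁ ℓ″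
      y″ = proj₁ (proj₂ ℓ″)
      sup′ : Supported (lines Y′) v (x′ , y′)
      sup′ = proj₁ (meets-on (lines Y′) v ℓ′)
      sup″ : Supported (lines Y′) v (x″ , y″)
      sup″ = proj₁ (meets-on (lines Y′) v ℓ″)
      on-s′ = proj₂ (meets-on (lines Y′) v ℓ′)
      on-t″ = proj₂ (meets-on (lines Y′) v ℓ″)
      elsewhere : ∀ {p} → Supported (lines Y′) v p →
        ∀ j → j ≢ v → j ≢ w → On (lookup T j) (lookup (proj₁ p) j) (lookup (proj₂ p) j)
      elsewhere (_ , _ , on) j j≢v j≢w =
        at⁻ Y j refl (at Y′ j (toggle-other Y j≢w) (on j j≢v))
      balance : ∀ {p} → Supported (lines Y′) v p → ωat (x , y) p v xor ωat (x , y) p w ≡ false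
      balance {x₁ , y₁} sup@(Lx₁ , Ky₁ , _) = trans
        (sym (ω-double (x , y) (x₁ , y₁) (≢-sym w≢v)
          (λ j j≢v j≢w → On-isotropic (lookup T j) (on-T j j≢v) (elsewhere sup j j≢v j≢w))))
        (isotropic Lx Ky Lx₁ Ky₁)
      -- The lines of `Y` and `Y′` differ only at `w`, where `Y` has `y≡0`; a vector with y = 0 at
      -- `w` thus also lies on the lines of `Y`.
      isolated′ : ∀ {p} → Supported (lines Y′) v p → On s (lookup (proj₁ p) v) (lookup (proj₂ p) v) →
        (∃ λ j → lookup (proj₁ p) j ∨ lookup (proj₂ p) j ≡ true) → ¬ lookup (proj₂ p) w ≡ false
      isolated′ {x₁ , y₁} sup@(Lx₁ , Ky₁ , on) on-s nz₁ y₁w = isolated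
        (x₁ , y₁ , Lx₁ , Ky₁ , On-update T v x₁ y₁ on₁ on-s , nz₁)
        where
        on₁ : ∀ j → j ≢ v → On (lookup T j) (lookup x₁ j) (lookup y₁ j)
        on₁ j j≢v with j Fin.≟ w
        ... | yes refl = at⁻ Y j w∉Y y₁w
        ... | no j≢w   = elsewhere sup j j≢v j≢w
      ωat-w : ∀ x₁ y₁ → ωat (x , y) (x₁ , y₁) w ≡ lookup y₁ w
      ωat-w x₁ y₁ = trans (cong₂ (λ a b → (a ∧ lookup y₁ w) xor (b ∧ lookup x₁ w)) xw yw) (xor-identityʳ _)
      y′w : lookup y′ w ≡ true
      y′w with lookup y′ w in eq
      ... | true  = refl
      ... | false = contradiction eq (isolated′ sup′ on-s′ (proj₂ (proj₂ (proj₂ (proj₂ (proj₂ ℓ′))))))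
      xor-false : ∀ a b → a xor b ≡ false → a ≡ b
      xor-false false b     eq = sym eq
      xor-false true  true  eq = refl
      -- The term at `w` in the pairing with `(x , y)` is one, so the term at `v` is one too.
      nz′ : lookup x′ v ∨ lookup y′ v ≡ true
      nz′ with trans (xor-false (ωat (x , y) (x′ , y′) v) _ (balance sup′)) (trans (ωat-w x′ y′) y′w)
      ... | ωv with lookup x′ v | lookup y′ v
      ...   | true  | _     = refl
      ...   | false | true  = refl
      ...   | false | false = true≢false ωv (cong₂ _xor_ (∧-zeroʳ (lookup x v)) (∧-zeroʳ (lookup y v)))
      -- Both vectors lie on `t` at `v`, so the term at `v` vanishes, and with it the term at `w`.
      y″w : lookup y″ w ≡ false
      y″w = trans (sym (ωat-w x″ y″)) (trans (sym (xor-false (ωat (x , y) (x″ , y″) v) _ (balance sup″)))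
        (On-isotropic t on-t on-t″))
      ω′″ : ωat (x′ , y′) (x″ , y″) v ≡ false
      ω′″ = Supported-ωat (lines Y′) v sup′ sup″
      contradiction″ : Empty.⊥
      -- At `v`, `(x″ , y″)` lies on `t` and is orthogonal to a nonzero vector on `s`; hence it
      -- vanishes there and lies on `s` as well.
      contradiction″ = isolated′ sup″
        (On-zero s (On-distinct s≢t (lookup x′ v) (lookup y′ v) (lookup x″ v) (lookup y″ v) on-s′ on-t″ ω′″ nz′))
        (proj₂ (proj₂ (proj₂ (proj₂ (proj₂ ℓ″))))) y″w
    diagonal : ∀ j → j ≢ v → lookup x j ≡ lookup y j
    diagonal j j≢v with lookup Y j in Yj
    ... | true  = at Y j Yj (on-T j j≢v)
    ... | false = let yj = at Y j Yj (on-T j j≢v) in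
      trans (≢true⇒false (no-outlier j j≢v Yj yj)) (sym yj)

  -- The hypothesis on N says that N = M + V when M has the bases of the matroid with cycle space K.
  module _ (N : SetSystem n) (N-transverse : ∀ Y → N Y ≡ transverse (Vec.map fundamentalLine Y)) (v : Fin n) where

    private
      update-out : ∀ Y → lookup Y v ≡ false → Vec.map fundamentalLine Y ≡ Vec.map fundamentalLine Y [ v ]≔ y≡0
      update-out Y v∉Y = sym (updateAt-id-local v (Vec.map fundamentalLine Y)
        (sym (trans (lookup-map v fundamentalLine Y) (cong fundamentalLine v∉Y))))

      update-in : ∀ Y → lookup Y v ≡ false →
        Vec.map fundamentalLine (toggle Y v) ≡ Vec.map fundamentalLine Y [ v ]≔ x≡y
      update-in Y v∉Y = map-updateAt Y v (cong (fundamentalLine ∘ not) v∉Y)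

      N-out : ∀ Y → lookup Y v ≡ false → N Y ≡ transverse (Vec.map fundamentalLine Y [ v ]≔ y≡0)
      N-out Y v∉Y = trans (N-transverse Y) (cong transverse (update-out Y v∉Y))

      N-in : ∀ Y → lookup Y v ≡ false → N (toggle Y v) ≡ transverse (Vec.map fundamentalLine Y [ v ]≔ x≡y)
      N-in Y v∉Y = trans (N-transverse (toggle Y v)) (cong transverse (update-in Y v∉Y))

      xor-move : ∀ {a b c} → a xor b ≡ c → a xor c ≡ b
      xor-move {a} {b} refl = trans (sym (xor-assoc a a b)) (cong (_xor b) (xor-same a))

    R⇒DiagonalOff : Avoids N v → DiagonalOff x≡y v
    R⇒DiagonalOff = avoids⇒DiagonalOff (λ ()) N-out N-in

    Q⇒DiagonalOff : Avoids (N ⋆ ⁅ v ⁆) v → DiagonalOff y≡0 v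
    Q⇒DiagonalOff = avoids⇒DiagonalOff (λ ())
      (λ Y v∉Y → trans (Minors.⋆-del N v Y) (N-in Y v∉Y))
      (λ Y v∉Y → trans (Minors.⋆-con N v Y) (N-out Y v∉Y))

    -- Adding `v` to a set in `N + v` is governed by the sum of the choices `y≡0` and `x≡y`, which
    -- `transverse-xor` identifies with `x≡0`.
    P⇒DiagonalOff : Avoids (N ⊕ ⁅ v ⁆) v → DiagonalOff x≡0 v
    P⇒DiagonalOff = avoids⇒DiagonalOff (λ ())
      (λ Y v∉Y → trans (Minors.⊕-del N v Y v∉Y) (N-out Y v∉Y))
      (λ Y v∉Y → trans (Minors.⊕-con N v Y v∉Y) (trans (cong₂ _xor_ (N-out Y v∉Y) (N-in Y v∉Y))
        (xor-move {transverse (Vec.map fundamentalLine Y [ v ]≔ y≡0)} (transverse-xor (Vec.map fundamentalLine Y) v))))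

-- Binary matroids

-self : ∀ (X : Subset n) v → lookup (X - v) v ≡ false
-self (x ∷ X) zero    = refl
-self (x ∷ X) (suc v) = -self X v

-other : ∀ (X : Subset n) {v j} → j ≢ v → lookup (X - v) j ≡ lookup X j
-other (x ∷ X) {zero}  {zero}  j≢v = contradiction refl j≢v
-other (x ∷ X) {zero}  {suc j} j≢v = cong (λ Z → lookup Z j) (p─⊥≡p X)
-other (x ∷ X) {suc v} {zero}  j≢v = refl
-other (x ∷ X) {suc v} {suc j} j≢v = -other X (j≢v ∘ cong suc)

∣∣%2 : ∀ (X : Subset n) → ∣ X ∣ % 2 ≡ (if parity X then 1 else 0)
∣∣%2 []            = refl
∣∣%2 (outside ∷ X) = ∣∣%2 X
∣∣%2 (inside ∷ X)  = trans (%-distribˡ-+ 1 ∣ X ∣ 2)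
  (trans (cong (λ k → (1 ℕ.+ k) % 2) (∣∣%2 X)) (flip-bit (parity X)))
  where
  flip-bit : ∀ b → (1 ℕ.+ (if b then 1 else 0)) % 2 ≡ (if not b then 1 else 0)
  flip-bit false = refl
  flip-bit true  = refl

even⇒parity : ∀ (X : Subset n) → ∣ X ∣ % 2 ≡ 0 → parity X ≡ false
even⇒parity X even with parity X | ∣∣%2 X
... | false | _   = refl
... | true  | odd = contradiction (trans (sym odd) even) λ ()

parity⇒even : ∀ (X : Subset n) → parity X ≡ false → ∣ X ∣ % 2 ≡ 0
parity⇒even X eq = trans (∣∣%2 X) (cong (if_then 1 else 0) eq)

module Representation (f : Fin n → Vec Bool m) where

  -- The kernel of the matrix with columns `f`, and its row space given as an orthogonal complement.
  -- `InCS⇒K` and `K⇒InCS` later identify the kernel with the span of the circuits.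
  K L : Subset n → Set
  K y = colSum f y ≡ zeros m
  L x = ∀ y → K y → dot x y ≡ false

  K? : ∀ y → Dec (K y)
  K? y = ≡-dec Bool._≟_ (colSum f y) (zeros m)

  L? : ∀ x → Dec (L x)
  L? x with anySubset? (λ y → K? y ×-dec (dot x y Bool.≟ true))
  ... | yes (y , Ky , eq) = no λ Lx → true≢false eq (Lx y Ky)
  ... | no none           = yes λ y Ky → ≢true⇒false λ eq → none (y , Ky , eq)

  row : Fin m → Subset n
  row k = Vec.tabulate λ i → lookup (f i) k

  L⊥K : ∀ {x y} → L x → K y → dot x y ≡ false
  L⊥K Lx Ky = Lx _ Ky

colSum-row : ∀ (f : Fin n → Vec Bool m) y k → lookup (colSum f y) k ≡ dot y (Representation.row f k)
colSum-row f []      k = lookup-replicate k false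
colSum-row f (b ∷ y) k = trans (lookup-zipWith _xor_ k (if b then f zero else zeros _) _)
  (cong₂ _xor_ (first b) (colSum-row (f ∘ suc) y k))
  where
  first : ∀ b → lookup (if b then f zero else zeros _) k ≡ b ∧ lookup (f zero) k
  first true  = refl
  first false = lookup-replicate k false

module BinaryMatroid {M : SetSystem n} (f : Fin n → Vec Bool m)
  (bases : ∀ X → (M X ≡ true → IsVectorBasis f X) × (IsVectorBasis f X → M X ≡ true)) where

  open Representation f

  -- Each row of the matrix lies in `L`, and orthogonality to the rows means that every coordinate
  -- of the column sum vanishes.
  K-max : ∀ y → (∀ x → L x → dot x y ≡ false) → K y
  K-max y h = lookup-ext λ k → begin
    lookup (colSum f y) k ≡⟨ colSum-row f y k ⟩
    dot y (row k)         ≡⟨ dot-comm y (row k) ⟩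
    dot (row k) y         ≡⟨ h (row k) (L-row k) ⟩
    false                 ≡⟨ lookup-replicate k false ⟨
    lookup (zeros m) k    ∎
    where
    open ≡-Reasoning
    L-row : ∀ k → L (row k)
    L-row k z Kz = trans (dot-comm (row k) z) (trans (sym (colSum-row f z k))
      (trans (cong (λ u → lookup u k) Kz) (lookup-replicate k false)))

  open Lagrangian L K L? K? (λ {x} {y} → L⊥K {x} {y}) (λ _ Lx → Lx) K-max public

  Dependent : Subset n → Set
  Dependent X = ∃ λ Y → Y ⊆ X × K Y × ∃ λ i → lookup Y i ≡ true

  indep⊎dependent : ∀ X → LinIndep f X ⊎ Dependent X
  indep⊎dependent X with anySubset? (λ Y → (Y ⊆? X) ×-dec K? Y ×-dec Fin.any? (λ i → lookup Y i Bool.≟ true))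
  ... | yes dep = inj₂ dep
  ... | no ¬dep = inj₁ indep
    where
    indep : LinIndep f X
    indep Y Y⊆X KY with ⊥⊎∃ Y
    ... | inj₁ eq = eq
    ... | inj₂ nz = Empty.⊥-elim (¬dep (Y , Y⊆X , KY , nz))

  nonzero : ∀ {Y : Subset n} {i} → lookup Y i ≡ true → ¬ Y ≡ ⊥
  nonzero {i = i} Yi refl = true≢false Yi (⊥-lookup i)

  dependent⇒¬indep : ∀ {X} → Dependent X → ¬ LinIndep f X
  dependent⇒¬indep (Y , Y⊆X , KY , i , Yi) indep = nonzero Yi (indep Y Y⊆X KY)

  LinIndep? : ∀ X → Dec (LinIndep f X)
  LinIndep? X with indep⊎dependent X
  ... | inj₁ indep = yes indep
  ... | inj₂ dep   = no (dependent⇒¬indep dep)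

  indep-⊆ : ∀ {X Y} → X ⊆ Y → LinIndep f Y → LinIndep f X
  indep-⊆ X⊆Y indep Z Z⊆X = indep Z (λ i∈Z → X⊆Y (Z⊆X i∈Z))

  ⊆-toggle : ∀ (X : Subset n) {i} → lookup X i ≡ false → X ⊆ toggle X i
  ⊆-toggle X {i} i∉X = ⊆-lookup λ j Xj →
    toggle-off X (λ { refl → true≢false Xj i∉X }) Xj

  toggle-⊆ : ∀ {X Y : Subset n} {i} → X ⊆ Y → lookup Y i ≡ true → toggle X i ⊆ Y
  toggle-⊆ {X} {Y} {i} X⊆Y Yi = ⊆-lookup in-Y
    where
    in-Y : ∀ j → lookup (toggle X i) j ≡ true → lookup Y j ≡ true
    in-Y j eq with j Fin.≟ i
    ... | yes refl = Yi
    ... | no j≢i   = lookup-⊆ X⊆Y j (trans (sym (toggle-other X j≢i)) eq)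

  extend : ∀ k X → n ≤ k ℕ.+ ∣ X ∣ → LinIndep f X → ∃ λ B → IsVectorBasis f B × X ⊆ B
  extend k X n≤ indep with Fin.any? (λ i → (lookup X i Bool.≟ false) ×-dec LinIndep? (toggle X i))
  ... | no none = X , (indep , maximal) , λ i∈X → i∈X
    where
    maximal : ∀ Y → X ⊆ Y → LinIndep f Y → Y ≡ X
    maximal Y X⊆Y indep-Y with ⊆⊎∃ Y X
    ... | inj₁ Y⊆X = ⊆-antisym Y⊆X X⊆Y
    ... | inj₂ (i , Yi , Xi) = contradiction (i , Xi , indep-⊆ (toggle-⊆ X⊆Y Yi) indep-Y) none
  extend zero    X n≤ indep | yes (i , i∉X , _) =
    contradiction (ℕ.≤-trans (ℕ.≤-reflexive (sym (∣toggle∣-out X i i∉X))) (∣p∣≤n (toggle X i))) (ℕ.≤⇒≯ n≤)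
  extend (suc k) X n≤ indep | yes (i , i∉X , indep′) with extend k (toggle X i)
    (subst (n ≤_) (trans (sym (ℕ.+-suc k ∣ X ∣)) (cong (k ℕ.+_) (sym (∣toggle∣-out X i i∉X)))) n≤) indep′
  ... | B , basis , ⊆B = B , basis , λ i∈X → ⊆B (⊆-toggle X i∉X i∈X)

  linIndep⇒independent : ∀ {X} → LinIndep f X → Independent M X
  linIndep⇒independent {X} indep with extend n X (ℕ.m≤m+n n _) indep
  ... | B , basis , X⊆B = B , proj₂ (bases B) basis , X⊆B

  independent⇒linIndep : ∀ {X} → Independent M X → LinIndep f X
  independent⇒linIndep (B , MB , X⊆B) = indep-⊆ X⊆B (proj₁ (proj₁ (bases B) MB))

  circuit⇒K : ∀ {C} → IsCircuit M C → K C
  circuit⇒K {C} (¬indep , minimal) with indep⊎dependent C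
  ... | inj₁ indep = contradiction (linIndep⇒independent indep) ¬indep
  ... | inj₂ (Y , Y⊆C , KY , i , Yi) with ⊆⊎∃ C Y
  ...   | inj₁ C⊆Y = subst K (⊆-antisym Y⊆C C⊆Y) KY
  ...   | inj₂ (j , Cj , Yj) = contradiction
    (independent⇒linIndep (minimal Y (Y⊆C , j , lookup⇒[]= j C Cj , λ j∈Y → true≢false ([]=⇒lookup j∈Y) Yj)))
    (dependent⇒¬indep (Y , (λ i∈Y → i∈Y) , KY , i , Yi))

  InCS⇒K : ∀ {X} → InCS M X → K X
  InCS⇒K cs-zero       = K-⊥
  InCS⇒K (cs-add cs c) = K-△ (InCS⇒K cs) (circuit⇒K c)

  InCS-△ : ∀ {X Y} → InCS M X → InCS M Y → InCS M (X △ Y)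
  InCS-△ {X} csX cs-zero = subst (InCS M) (sym (△-⊥ X)) csX
    where
    △-⊥ : ∀ (X : Subset n) → X △ ⊥ ≡ X
    △-⊥ X = lookup-ext λ i → trans (△-lookup X ⊥ i) (trans (cong (lookup X i xor_) (⊥-lookup i)) (xor-identityʳ _))
  InCS-△ {X} csX (cs-add {Y} {C} csY c) = subst (InCS M) (△-assoc X Y C) (cs-add (InCS-△ csX csY) c)
    where
    △-assoc : ∀ (X Y Z : Subset n) → (X △ Y) △ Z ≡ X △ (Y △ Z)
    △-assoc = zipWith-assoc xor-assoc

  -- A nonempty proper subset of X in K splits X into two smaller members of K; otherwise X is a circuit.
  K⇒InCS : ∀ {X} → K X → InCS M X
  K⇒InCS {X} KX = go _ X ℕ.≤-refl KX
    where
    go : ∀ k X → ∣ X ∣ ≤ k → K X → InCS M X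
    go k X X≤k KX with ⊥⊎∃ X
    ... | inj₁ refl = cs-zero
    ... | inj₂ (i , Xi) with anySubset? (λ Y → (Y ⊂? X) ×-dec K? Y ×-dec Fin.any? (λ j → lookup Y j Bool.≟ true))
    ...   | no none = subst (InCS M) (△-identityˡ X) (cs-add cs-zero
      ((λ indep → dependent⇒¬indep (X , (λ i∈X → i∈X) , KX , i , Xi) (independent⇒linIndep indep)) ,
       (λ Y Y⊂X → linIndep⇒independent (indep-proper Y Y⊂X))))
      where
      △-identityˡ : ∀ (X : Subset n) → ⊥ △ X ≡ X
      △-identityˡ X = lookup-ext λ j → trans (△-lookup ⊥ X j) (cong (_xor lookup X j) (⊥-lookup j))
      indep-proper : ∀ Y → Y ⊂ X → LinIndep f Y
      indep-proper Y (Y⊆X , x , x∈X , x∉Y) with indep⊎dependent Y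
      ... | inj₁ indep = indep
      ... | inj₂ (Z , Z⊆Y , KZ , nz) = Empty.⊥-elim (none
        (Z , ((λ z∈Z → Y⊆X (Z⊆Y z∈Z)) , x , x∈X , λ x∈Z → x∉Y (Z⊆Y x∈Z)) , KZ , nz))
    ...   | yes (Y , Y⊂X , KY , j , Yj) = split k X≤k
      where
      rest⊆X : (X △ Y) ⊆ X
      rest⊆X = ⊆-lookup λ l eq → in-X l (trans (sym (△-lookup X Y l)) eq)
        where
        in-X : ∀ l → lookup X l xor lookup Y l ≡ true → lookup X l ≡ true
        in-X l eq with lookup X l in Xl
        ... | true  = refl
        ... | false = true≢false (lookup-⊆ (proj₁ Y⊂X) l eq) Xl
      rest⊂X : (X △ Y) ⊂ X
      rest⊂X = rest⊆X , j , proj₁ Y⊂X (lookup⇒[]= j Y Yj) , λ j∈ → true≢false ([]=⇒lookup j∈)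
        (trans (△-lookup X Y j) (cong₂ _xor_ (lookup-⊆ (proj₁ Y⊂X) j Yj) Yj))
      split : ∀ k → ∣ X ∣ ≤ k → InCS M X
      split zero    X≤0 = contradiction (ℕ.≤-trans (p⊂q⇒∣p∣<∣q∣ Y⊂X) X≤0) λ ()
      split (suc k) X≤1+k = subst (InCS M) (△-cancelʳ X Y)
        (InCS-△ (go k (X △ Y) (s≤s⁻¹ (ℕ.≤-trans (p⊂q⇒∣p∣<∣q∣ rest⊂X) X≤1+k)) (K-△ KX KY))
                (go k Y (s≤s⁻¹ (ℕ.≤-trans (p⊂q⇒∣p∣<∣q∣ Y⊂X) X≤1+k)) KY))

  InCSperp⇒L : ∀ {X} → InCSperp M X → L X
  InCSperp⇒L {X} perp y Ky = trans (dot-comm X y) (even⇒parity (y ∩ X) (perp y (K⇒InCS Ky)))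

  L⇒InCSperp : ∀ {X} → L X → InCSperp M X
  L⇒InCSperp {X} LX Y csY = parity⇒even (Y ∩ X) (trans (dot-comm Y X) (LX Y (InCS⇒K csY)))

  on-basisLine : ∀ (Y : Subset n) j {b x y} → lookup Y j ≡ b → On (basisLine b) x y → On (lookup (Vec.map basisLine Y) j) x y
  on-basisLine Y j {x = x} {y} refl = subst (λ t → On t x y) (sym (lookup-map j basisLine Y))

  on-basisLine⁻ : ∀ (Y : Subset n) j {b x y} → lookup Y j ≡ b → On (lookup (Vec.map basisLine Y) j) x y → On (basisLine b) x y
  on-basisLine⁻ Y j {x = x} {y} refl = subst (λ t → On t x y) (lookup-map j basisLine Y)

  -- A witness has y in the kernel and inside `Y`, hence y = 0, so x contains some `j` outside `Y`.
  -- By maximality `Y ∪ {j}` contains a dependency, which must use `j`. As x avoids `Y`, the two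
  -- meet in `j` alone, against orthogonality.
  basis⇒¬meets : ∀ Y → IsVectorBasis f Y → ¬ Meets (Vec.map basisLine Y)
  basis⇒¬meets Y (indep , maximal) (x , y , Lx , Ky , on , j , nz) = absurd (indep⊎dependent (toggle Y j))
    where
    y⊆Y : y ⊆ Y
    y⊆Y = ⊆-lookup λ l yl → in-Y l yl
      where
      in-Y : ∀ l → lookup y l ≡ true → lookup Y l ≡ true
      in-Y l yl with lookup Y l in Yl
      ... | true  = refl
      ... | false = true≢false yl (on-basisLine⁻ Y l {x = lookup x l} Yl (on l))
    y≡⊥ : y ≡ ⊥
    y≡⊥ = indep y y⊆Y Ky
    xj : lookup x j ≡ true
    xj = trans (sym (trans (cong (λ z → lookup x j ∨ lookup z j) y≡⊥)
      (trans (cong (lookup x j ∨_) (⊥-lookup j)) (∨-identityʳ _)))) nz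
    x∩Y : ∀ l → lookup Y l ≡ true → lookup x l ≡ false
    x∩Y l Yl = on-basisLine⁻ Y l {y = lookup y l} Yl (on l)
    j∉Y : lookup Y j ≡ false
    j∉Y = ≢true⇒false λ Yj → true≢false xj (x∩Y j Yj)
    absurd : LinIndep f (toggle Y j) ⊎ Dependent (toggle Y j) → Empty.⊥
    absurd (inj₁ indep′) = true≢false (toggle-on Y j j∉Y)
      (subst (λ Z → lookup Z j ≡ false) (sym (maximal (toggle Y j) (⊆-toggle Y j∉Y) indep′)) j∉Y)
    absurd (inj₂ (z , z⊆ , Kz , i , zi)) with lookup z j in zj
    ... | false = nonzero zi (indep z (⊆-lookup λ l zl → trans
      (sym (toggle-other Y λ { refl → true≢false zl zj })) (lookup-⊆ z⊆ l zl)) Kz)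
    ... | true = true≢false (trans (parity-single (x ∩ z) j others) (trans (∩-lookup x z j) (cong₂ _∧_ xj zj)))
                            (Lx z Kz)
      where
      others : ∀ l → l ≢ j → lookup (x ∩ z) l ≡ false
      others l l≢j with lookup z l in zl
      ... | false = trans (∩-lookup x z l) (trans (cong (lookup x l ∧_) zl) (∧-zeroʳ _))
      ... | true  = trans (∩-lookup x z l)
        (cong (_∧ lookup z l) (x∩Y l (trans (sym (toggle-other Y l≢j)) (lookup-⊆ z⊆ l zl))))

  -- A dependency `Z` inside `Y` would give the witness `(⊥ , Z)`. For maximality, apply
  -- `nonzero-at` at a new element `j`: if y contains `j`, then y is a dependency inside `Y′`;
  -- otherwise the vector is itself a witness.
  ¬meets⇒basis : ∀ Y → ¬ Meets (Vec.map basisLine Y) → IsVectorBasis f Y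
  ¬meets⇒basis Y ¬meets = indep , maximal
    where
    indep : LinIndep f Y
    indep Z Z⊆Y KZ with ⊥⊎∃ Z
    ... | inj₁ eq = eq
    ... | inj₂ (i , Zi) = contradiction
      (⊥ , Z , L-⊥ , KZ , on , i , trans (cong (lookup ⊥ i ∨_) Zi) (∨-zeroʳ _)) ¬meets
      where
      on : ∀ j → On (lookup (Vec.map basisLine Y) j) (lookup ⊥ j) (lookup Z j)
      on j with lookup Y j in Yj
      ... | true  = on-basisLine Y j {y = lookup Z j} Yj (⊥-lookup j)
      ... | false = on-basisLine Y j {x = lookup ⊥ j} Yj
        (≢true⇒false λ Zj → true≢false (lookup-⊆ Z⊆Y j Zj) Yj)
    maximal : ∀ Y′ → Y ⊆ Y′ → LinIndep f Y′ → Y′ ≡ Y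
    maximal Y′ Y⊆Y′ indep′ with ⊆⊎∃ Y′ Y
    ... | inj₁ Y′⊆Y = ⊆-antisym Y′⊆Y Y⊆Y′
    ... | inj₂ (j , Y′j , Yj) with nonzero-at (Vec.map basisLine Y) j
    ...   | x , y , (Lx , Ky , on) , nz with lookup y j in yj
    ...     | true = contradiction (indep′ y (⊆-lookup in-Y′) Ky) (nonzero yj)
      where
      in-Y′ : ∀ l → lookup y l ≡ true → lookup Y′ l ≡ true
      in-Y′ l yl with l Fin.≟ j
      ... | yes refl = Y′j
      ... | no l≢j with lookup Y l in Yl
      ...   | true  = lookup-⊆ Y⊆Y′ l Yl
      ...   | false = true≢false yl (on-basisLine⁻ Y l {x = lookup x l} Yl (on l l≢j))
    ...     | false = contradiction
      (x , y , Lx , Ky , on′ , j , trans (cong (lookup x j ∨_) yj) nz) ¬meets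
      where
      on′ : ∀ l → On (lookup (Vec.map basisLine Y) l) (lookup x l) (lookup y l)
      on′ l with l Fin.≟ j
      ... | yes refl = on-basisLine Y l {x = lookup x l} Yj yj
      ... | no l≢j   = on l l≢j

  M-transverse : ∀ Y → M Y ≡ transverse (Vec.map basisLine Y)
  M-transverse Y with M Y in MY
  ... | true  = sym (¬meets⇒transverse (Vec.map basisLine Y) (basis⇒¬meets Y (proj₁ (bases Y) MY)))
  ... | false = sym (≢true⇒false λ eq →
    true≢false (proj₂ (bases Y) (¬meets⇒basis Y (transverse⇒¬meets (Vec.map basisLine Y) eq))) MY)

  M+V-transverse : ∀ Y → (M ⊕ full n) Y ≡ transverse (Vec.map fundamentalLine Y)
  M+V-transverse = ⊕-full M transverse transverse-xor M-transverse

  minus≡ : ∀ (x y : Subset n) v → (∀ j → j ≢ v → lookup x j ≡ lookup y j) → lookup x v ≡ false → y - v ≡ x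
  minus≡ x y v diag x∌v = lookup-ext pointwise
    where
    pointwise : ∀ j → lookup (y - v) j ≡ lookup x j
    pointwise j with j Fin.≟ v
    ... | yes refl = trans (-self y v) (sym x∌v)
    ... | no j≢v   = trans (-other y j≢v) (sym (diag j j≢v))

  -- The component at `v` is `(0 , 1)`, so removing `v` from the cycle `y` leaves `x`.
  DiagonalOff⇒P0 : ∀ {v} → DiagonalOff x≡0 v → InP0 M v
  DiagonalOff⇒P0 {v} (x , y , Lx , Ky , diag , xv , nz) = y , K⇒InCS Ky ,
    lookup⇒[]= v y (trans (cong (_∨ lookup y v) (sym xv)) nz) ,
    L⇒InCSperp (subst L (sym (minus≡ x y v diag xv)) Lx)

  DiagonalOff⇒Q0 : ∀ {v} → DiagonalOff y≡0 v → InQ0 M v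
  DiagonalOff⇒Q0 {v} (x , y , Lx , Ky , diag , yv , nz) = x , L⇒InCSperp Lx ,
    lookup⇒[]= v x (trans (sym (trans (cong (lookup x v ∨_) yv) (∨-identityʳ _))) nz) ,
    K⇒InCS (subst K (sym (minus≡ y x v (λ j j≢v → sym (diag j j≢v)) yv)) Ky)

  DiagonalOff⇒R0 : ∀ {v} → DiagonalOff x≡y v → InR0 M v
  DiagonalOff⇒R0 {v} (x , y , Lx , Ky , diag , xv≡yv , nz) = y , (K⇒InCS Ky , L⇒InCSperp (subst L x≡y′ Lx)) ,
    lookup⇒[]= v y (trans (sym (trans (cong (_∨ lookup y v) xv≡yv) (∨-idem _))) nz)
    where
    pointwise : ∀ j → lookup x j ≡ lookup y j
    pointwise j with j Fin.≟ v
    ... | yes refl = xv≡yv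
    ... | no j≢v   = diag j j≢v
    x≡y′ : x ≡ y
    x≡y′ = lookup-ext pointwise

  P0⇒DiagonalOff : ∀ {v} → InP0 M v → DiagonalOff x≡0 v
  P0⇒DiagonalOff {v} (X , csX , v∈X , perp) = X - v , X , InCSperp⇒L perp , InCS⇒K csX ,
    (λ j j≢v → -other X j≢v) , -self X v , trans (cong (lookup (X - v) v ∨_) ([]=⇒lookup v∈X)) (∨-zeroʳ _)

  Q0⇒DiagonalOff : ∀ {v} → InQ0 M v → DiagonalOff y≡0 v
  Q0⇒DiagonalOff {v} (X , perp , v∈X , cs) = X , X - v , InCSperp⇒L perp , InCS⇒K cs ,
    (λ j j≢v → sym (-other X j≢v)) , -self X v , cong (_∨ lookup (X - v) v) ([]=⇒lookup v∈X)

  R0⇒DiagonalOff : ∀ {v} → InR0 M v → DiagonalOff x≡y v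
  R0⇒DiagonalOff {v} (X , (cs , perp) , v∈X) = X , X , InCSperp⇒L perp , InCS⇒K cs ,
    (λ _ _ → refl) , refl , cong (_∨ lookup X v) ([]=⇒lookup v∈X)

-- Partitions under inclusion, and the theorem

exactlyOne-map : ∀ {A B C A′ B′ C′ : Set} → A ⇔ A′ → B ⇔ B′ → C ⇔ C′ → ExactlyOne A B C → ExactlyOne A′ B′ C′
exactlyOne-map (f , f⁻) (g , g⁻) (h , h⁻) (inj₁ (a , ¬b , ¬c)) = inj₁ (f a , ¬b ∘ g⁻ , ¬c ∘ h⁻)
exactlyOne-map (f , f⁻) (g , g⁻) (h , h⁻) (inj₂ (inj₁ (¬a , b , ¬c))) = inj₂ (inj₁ (¬a ∘ f⁻ , g b , ¬c ∘ h⁻))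
exactlyOne-map (f , f⁻) (g , g⁻) (h , h⁻) (inj₂ (inj₂ (¬a , ¬b , c))) = inj₂ (inj₂ (¬a ∘ f⁻ , ¬b ∘ g⁻ , h c))

-- Pairwise disjoint sets containing the respective blocks of a partition coincide with them; one
-- inclusion per block thus suffices.
exactlyOne-⇔ : ∀ {A B C A′ B′ C′ : Set} → ExactlyOne A B C → (A → A′) → (B → B′) → (C → C′) →
  (A′ → ¬ B′) → (A′ → ¬ C′) → (B′ → ¬ C′) → (A ⇔ A′) × (B ⇔ B′) × (C ⇔ C′)
exactlyOne-⇔ (inj₁ (a , ¬b , ¬c)) f g h ab ac bc =
  (f , λ _ → a) , (g , λ b′ → contradiction b′ (ab (f a))) , (h , λ c′ → contradiction c′ (ac (f a)))
exactlyOne-⇔ (inj₂ (inj₁ (¬a , b , ¬c))) f g h ab ac bc =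
  (f , λ a′ → contradiction (g b) (ab a′)) , (g , λ _ → b) , (h , λ c′ → contradiction c′ (bc (g b)))
exactlyOne-⇔ (inj₂ (inj₂ (¬a , ¬b , c))) f g h ab ac bc =
  (f , λ a′ → contradiction (h c) (ac a′)) , (g , λ b′ → contradiction (h c) (bc b′)) , (h , λ _ → c)

theorem4 : {n : ℕ} (M : SetSystem n) → VFSafe M →
    ((v : Fin n) → ExactlyOne (InP M v) (InQ M v) (InR M v)) ×
    (IsBinaryMatroid M →
    (v : Fin n) → (InP M v ⇔ InP0 M v) × (InQ M v ⇔ InQ0 M v) × (InR M v ⇔ InR0 M v))
theorem4 {n} M safe = exactlyOne , binary
  where
  N = M ⊕ full n
  safe-N : VFSafe N
  safe-N = VFSafe-⊕ safe (full n)
  avoidsP : ∀ {v} → InP M v → Avoids (N ⊕ ⁅ v ⁆) v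
  avoidsP {v} = ¬coloop⇒avoids (safe-N _ (loopc start ⁅ v ⁆))
  avoidsQ : ∀ {v} → InQ M v → Avoids (N ⋆ ⁅ v ⁆) v
  avoidsQ {v} = ¬coloop⇒avoids (safe-N _ (twist start ⁅ v ⁆))
  avoidsR : ∀ {v} → InR M v → Avoids N v
  avoidsR = ¬coloop⇒avoids (safe-N _ start)
  exactlyOne : ∀ v → ExactlyOne (InP M v) (InQ M v) (InR M v)
  exactlyOne v = exactlyOne-map (avoids⇒¬coloop , avoidsP) (avoids⇒¬coloop , avoidsQ) (avoids⇒¬coloop , avoidsR)
    (Minors.exactlyOne-avoids N v safe-N)
  binary : IsBinaryMatroid M → ∀ v → (InP M v ⇔ InP0 M v) × (InQ M v ⇔ InQ0 M v) × (InR M v ⇔ InR0 M v)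
  binary (m , f , bases) v = exactlyOne-⇔ (exactlyOne v)
    (λ p → DiagonalOff⇒P0 (P⇒DiagonalOff N M+V-transverse v (avoidsP p)))
    (λ q → DiagonalOff⇒Q0 (Q⇒DiagonalOff N M+V-transverse v (avoidsQ q)))
    (λ r → DiagonalOff⇒R0 (R⇒DiagonalOff N M+V-transverse v (avoidsR r)))
    (λ p q → DiagonalOff-disjoint {x≡0} {y≡0} (λ ()) (P0⇒DiagonalOff p) (Q0⇒DiagonalOff q))
    (λ p r → DiagonalOff-disjoint {x≡0} {x≡y} (λ ()) (P0⇒DiagonalOff p) (R0⇒DiagonalOff r))
    (λ q r → DiagonalOff-disjoint {y≡0} {x≡y} (λ ()) (Q0⇒DiagonalOff q) (R0⇒DiagonalOff r))
    where
    open BinaryMatroid f bases
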